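{- For any $\vec{\alpha}\in\mathbb{R}_+^d\setminus\{\vec{0}\}$ and $\rho\in\mathbb{R}$, one has $$\tilde{T}(\mathcal{P}_{\vec{\alpha},\rho})=\mathcal{P}_{T(\vec{\alpha}),\rho},$$ where $T$ is the Brun map on vectors and $\tilde{T}$ is the run-based map on binary stepped functions.
   Context: Fix an integer $d\geq 3$; $(\vec{e}_1,\ldots,\vec{e}_d)$ is the canonical basis of $\mathbb{R}^d$, $\langle\cdot|\cdot\rangle$ the standard scalar product, $\mathbb{R}_+$ the set of non-negative reals. A stepped function is a function $\mathcal{E}:\mathbb{Z}^d\times\{1,\ldots,d\}\to\mathbb{Z}$ (set $\mathfrak{F}$), compared pointwise by $\leq$; it is binary if it takes only the values $0$ and $1$ (set $\mathfrak{B}$). The face $(\vec{x},i^*)$ is the stepped function with value $1$ at $(\vec{x},i)$ and $0$ elsewhere. The stepped plane of normal vector $\vec{\alpha}\in\mathbb{R}_+^d\setminus\{\vec{0}\}$ and intercept $\rho\in\mathbb{R}$ is the binary stepped function $\mathcal{P}_{\vec{\alpha},\rho}$ such that $\mathcal{P}_{\vec{\alpha},\rho}(\vec{x},i)=1$ if and only if $\langle\vec{x}|\vec{\alpha}\rangle<\rho\leq\langle\vec{x}+\vec{e}_i|\vec{\alpha}\rangle$. Brun map. Let $X=\mathbb{R}_+^d\setminus\{\vec{0}\}$ and $X_0=\{\lambda\vec{e}_i \mid \lambda>0,\ 1\leq i\leq d\}$. For $\vec{\alpha}\in X_0$ put $B(\vec{\alpha})=I_d$. For $\vec{\alpha}=(\alpha_1,\ldots,\alpha_d)\in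 X\setminus X_0$, let $(i,j)$, $i\neq j$, be the lexicographically smallest pair with $\alpha_i=\max_{k}\alpha_k$ and $\alpha_j=\max_{k\neq i}\alpha_k$, let $a=\lfloor\alpha_i/\alpha_j\rfloor$, and let $B(\vec{\alpha})$ be the $d\times d$ matrix with $(i,i)$-entry $a$, $(i,j)$- and $(j,i)$-entries $1$, $(j,j)$-entry $0$, $(k,k)$-entry $1$ for $k\notin\{i,j\}$, and all other entries $0$. The Brun map is $T:X\to X$, $T(\vec{\alpha})=B(\vec{\alpha})^{ -1}\vec{\alpha}$. Dual maps. $F_d$ is the free group on $\{1,\ldots,d\}$ (elements in reduced form); $\vec{f}:F_d\to\mathbb{Z}^d$ sends $w$ to the vector whose $i$-th entry is the sum of the exponents of $i$ in $w$. The incidence matrix $M_\sigma$ of an endomorphism $\sigma$ of $F_d$ has $i$-th column $\vec{f}(\sigma(i))$; $\sigma$ is unimodular if $\det M_\sigma=\pm1$. The dual map $E_1^*(\sigma):\mathfrak{F}\to\mathfrak{F}$ of a unimodular $\sigma$ is $$E_1^*(\sigma)(\mathcal{E})(\vec{x},i)=\sum_{\sigma(i)=p\cdot j\cdot s}\mathcal{E}(M_\sigma\vec{x}+\vec{f}(p),j)-\sum_{\sigma(i)=p\cdot j^{ -1}\cdot s}\mathcal{E}(M_\sigma\vec{x}+\vec{f}(p)-\vec{e}_j,j),$$ the sums ranging over all occurrences in $\sigma(i)$ of letters $j$ (resp. inverse letters $j^{ -1}$), with $p$ the prefix before and $s$ the suffix after the occurrence. The Brun substitution $\beta_{a,i,j}$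 ($a\in\mathbb{N}$, $i\neq j$) is the automorphism of $F_d$ with $\beta_{a,i,j}(i)=i^aj$, $\beta_{a,i,j}(j)=i$, $\beta_{a,i,j}(k)=k$ for $k\notin\{i,j\}$; its inverse satisfies $\beta_{a,i,j}^{ -1}(i)=j$, $\beta_{a,i,j}^{ -1}(j)=j^{ -a}i$, $\beta_{a,i,j}^{ -1}(k)=k$. Runs. For $i\neq j$ and $\mathcal{B}\in\mathfrak{B}$, an $(\vec{e}_j,i)$-run of $\mathcal{B}$ is a non-zero binary stepped function $\mathcal{R}=\sum_{k\in I}(\vec{x}+k\vec{e}_j,i^*)$, where $\vec{x}\in\mathbb{Z}^d$ and $I$ is maximal among the intervals of $\mathbb{Z}$ such that $\mathcal{R}\leq\mathcal{B}$; its length is $\#I$ (possibly infinite). The map $\tilde{T}:\mathfrak{B}\to\mathfrak{F}$. Let $\mathcal{B}\in\mathfrak{B}$. Suppose there are $i\neq j$ in $\{1,\ldots,d\}$ such that (1) for any $k\neq i$, all $(\vec{e}_i,k)$-runs and (when $k\neq j$) all $(\vec{e}_j,k)$-runs of $\mathcal{B}$, if any, have length $1$; (2) $\mathcal{B}$ has at least one finite $(\vec{e}_j,i)$-run. Take the lexicographically smallest such pair $(i,j)$, let $a$ be the length of the shortest $(\vec{e}_j,i)$-run of $\mathcal{B}$, and set $\tilde{T}(\mathcal{B})=E_1^*(\beta_{a,i,j}^{ -1})(\mathcal{B})$. If there is no such pair, set $\tilde{T}(\mathcal{B})=\mathcal{B}$. -}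

module Defs where

open import Level using (0ℓ)
open import Data.Nat.Base as ℕ using (ℕ; zero; suc; s≤s)
import Data.Nat.Properties as ℕ
import Data.Nat.Induction as ℕ
open import Data.Integer.Base as ℤ using (ℤ; +_; -[1+_]; 0ℤ; 1ℤ; _◃_)
import Data.Integer.Properties as ℤ
import Data.Integer.Tactic.RingSolver as ℤRing
open import Data.Sign.Base as Sign using (Sign)
open import Data.Bool.Base using (Bool; true; false; T; if_then_else_; _∧_)
open import Data.Fin.Base as Fin using (Fin; zero; suc; toℕ; punchIn; punchOut)
import Data.Fin.Properties as Fin
import Data.Fin.Induction as Fin
open import Data.List.Base as List using (List; []; _∷_; [_]; _++_)
open import Data.List.Relation.Unary.Linked as Linked using (Linked; []; [-]; _∷_)
open import Data.Vec.Base as Vec using (Vec)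
open import Data.Vec.Functional using (Vector)
import Data.Vec.Properties as Vec
open import Data.Product.Base using (Σ; ∃; ∃₂; ∃-syntax; _×_; _,_; proj₁; proj₂)
open import Data.Product.Relation.Binary.Lex.Strict using (×-Lex; ×-wellFounded)
open import Data.Sum.Base using (_⊎_; inj₁; inj₂)
open import Data.Empty using (⊥-elim)
open import Function.Base using (_∘_)
open import Function.Bundles using (_↔_)
open import Relation.Nullary using (¬_; Dec; yes; no; does; _×-dec_; contradiction)
open import Relation.Unary using (Pred)
open import Relation.Binary.Core using (Rel)
open import Relation.Binary.Definitions using (tri<; tri≈; tri>)
open import Relation.Binary.Structures using (IsStrictTotalOrder; IsDecTotalOrder)
import Relation.Binary.Construct.StrictToNonStrict as StrictToNonStrict
open import Relation.Binary.PropositionalEquality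
  using (_≡_; _≢_; refl; sym; trans; cong; cong₂; subst; module ≡-Reasoning)
open import Algebra.Core using (Op₁; Op₂)
open import Algebra.Structures using (IsCommutativeRing)
open import Algebra.Bundles using (CommutativeRing)
import Algebra.Definitions.RawMonoid as RawMonoidDefs
import Algebra.Properties.Ring as RingProperties
open import Algebra.Properties.Semiring.Sum ℤ.+-*-semiring
  using (sum; sum-cong-≗; sum-replicate-zero; *-distribˡ-sum; ∑-distrib-+)
open import Axiom.ExcludedMiddle using (ExcludedMiddle)
open import Induction.WellFounded using (WellFounded; Acc; acc)

-- The real numbers, axiomatized as a Dedekind-complete ordered field.  The
-- inverse is a total operation whose value at 0 is unspecified.

record Reals : Set₁ where
  infix  8 _⁻¹
  infixl 7 _*_
  infixl 6 _+_
  infix  4 _≈_ _<_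
  field
    Carrier            : Set
    _≈_ _<_            : Rel Carrier 0ℓ
    _+_ _*_            : Op₂ Carrier
    -_ _⁻¹             : Op₁ Carrier
    0# 1#              : Carrier
    isCommutativeRing  : IsCommutativeRing _≈_ _+_ _*_ -_ 0# 1#
    ⁻¹-inverseʳ        : ∀ x → ¬ x ≈ 0# → x * x ⁻¹ ≈ 1#
    isStrictTotalOrder : IsStrictTotalOrder _≈_ _<_
    0<1                : 0# < 1#
    +-monoʳ-<          : ∀ z {x y} → x < y → z + x < z + y
    *-pos              : ∀ {x y} → 0# < x → 0# < y → 0# < x * y

  open StrictToNonStrict _≈_ _<_ public using (_≤_)

  field
    complete : (S : Pred Carrier 0ℓ) → ∃ S → (∃[ b ] ∀ y → S y → y ≤ b) →
               ∃[ s ] (∀ y → S y → y ≤ s) ×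
                      (∀ b → (∀ y → S y → y ≤ b) → s ≤ b)

  commutativeRing : CommutativeRing 0ℓ 0ℓ
  commutativeRing = record { isCommutativeRing = isCommutativeRing }

  open CommutativeRing commutativeRing public using (ring; +-rawMonoid)
  open IsStrictTotalOrder isStrictTotalOrder public
    using (compare; _<?_) renaming (trans to <-trans)
  open IsDecTotalOrder (StrictToNonStrict.isDecTotalOrder _≈_ _<_ isStrictTotalOrder) public
    using (_≤?_; total) renaming (refl to ≤-refl; trans to ≤-trans)

  ι : ℤ → Carrier
  ι (+ n)    = RawMonoidDefs._×_ +-rawMonoid n 1#
  ι -[1+ n ] = - ι (+ suc n)

  ∑ : ∀ {n} → Vector Carrier n → Carrier
  ∑ = RawMonoidDefs.sum +-rawMonoid

δ : ∀ {d} → Fin d → Fin d → ℤ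
δ i j = if does (i Fin.≟ j) then 1ℤ else 0ℤ

-- Points of ℤᵈ are `Vec`s, so that equal points are propositionally equal.
Point : ℕ → Set
Point d = Vec ℤ d

infixl 6 _⊕_ _⊖_
infixr 7 _⊙_ _·_

_⊕_ _⊖_ : ∀ {d} → Point d → Point d → Point d
_⊕_ = Vec.zipWith ℤ._+_
_⊖_ = Vec.zipWith ℤ._-_

_⊙_ : ∀ {d} → ℤ → Point d → Point d
k ⊙ x = Vec.map (k ℤ.*_) x

e : ∀ {d} → Fin d → Point d
e i = Vec.tabulate (δ i)

Matrix : ℕ → Set
Matrix d = Fin d → Fin d → ℤ

_·_ : ∀ {d} → Matrix d → Point d → Point d
M · x = Vec.tabulate λ r → sum λ c → M r c ℤ.* Vec.lookup x c

_⊠_ : ∀ {d} → Matrix d → Matrix d → Matrix d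
(M ⊠ N) r c = sum λ l → M r l ℤ.* N l c

Inverses : ∀ {d} → Matrix d → Matrix d → Set
Inverses M N = (∀ r c → (M ⊠ N) r c ≡ δ r c) × (∀ r c → (N ⊠ M) r c ≡ δ r c)

Stepped : ℕ → Set
Stepped d = Point d → Fin d → ℤ

infix 4 _≐_ _≼_

_≐_ _≼_ : ∀ {d} → Stepped d → Stepped d → Set
E ≐ F = ∀ x i → E x i ≡ F x i
E ≼ F = ∀ x i → E x i ℤ.≤ F x i

record Binary (d : ℕ) : Set where
  field
    fun    : Stepped d
    binary : ∀ x i → fun x i ≡ 0ℤ ⊎ fun x i ≡ 1ℤ

face : ∀ {d} → Point d → Fin d → Stepped d
face x i y l = if does (Vec.≡-dec ℤ._≟_ y x) ∧ does (l Fin.≟ i) then 1ℤ else 0ℤ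

Letter : ℕ → Set
Letter d = Fin d × Sign

inv : ∀ {d} → Letter d → Letter d
inv (j , s) = j , Sign.opposite s

record FreeGroup (d : ℕ) : Set where
  field
    word    : List (Letter d)
    reduced : Linked (λ u v → u ≢ inv v) word

open FreeGroup

-- An endomorphism of the free group is given by the images of the generators.
Endo : ℕ → Set
Endo d = Fin d → FreeGroup d

abelianize : ∀ {d} → List (Letter d) → Point d
abelianize w = Vec.tabulate λ i →
  List.foldr (λ (j , s) n → (if does (j Fin.≟ i) then s ◃ 1 else 0ℤ) ℤ.+ n) 0ℤ w

incidence : ∀ {d} → Endo d → Matrix d
incidence σ r c = Vec.lookup (abelianize (word (σ c))) r

-- The k-th summand comes from the k-th letter of σ(i), whose prefix is `take k`.
-- The formula makes sense whether or not σ is unimodular.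
E₁* : ∀ {d} → Endo d → Stepped d → Stepped d
E₁* {d} σ E x i = sum λ k →
    contribution (List.lookup w k)
                 (incidence σ · x ⊕ abelianize (List.take (toℕ k) w))
  where
  w = word (σ i)

  contribution : Letter d → Point d → ℤ
  contribution (j , Sign.+) y = E y j
  contribution (j , Sign.-) y = ℤ.- E (y ⊖ e j) j

-- The inverse β⁻¹ of the Brun substitution i ↦ iᵃj, j ↦ i, k ↦ k.
β⁻¹ : ∀ {d} (a : ℕ) (i j : Fin d) → i ≢ j → Endo d
β⁻¹ {d} a i j i≢j k with k Fin.≟ i | k Fin.≟ j
... | yes _ | _     = record { word = [ j , Sign.+ ] ; reduced = [-] }
... | no _  | yes _ = record { word = j⁻ᵃi a ; reduced = j⁻ᵃi-reduced a }
  where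
  j⁻ᵃi : ℕ → List (Letter d)
  j⁻ᵃi n = List.replicate n (j , Sign.-) ++ [ i , Sign.+ ]

  j⁻ᵃi-reduced : ∀ n → Linked (λ u v → u ≢ inv v) (j⁻ᵃi n)
  j⁻ᵃi-reduced zero          = [-]
  j⁻ᵃi-reduced (suc zero)    = (λ eq → i≢j (sym (cong proj₁ eq))) ∷ [-]
  j⁻ᵃi-reduced (suc (suc n)) = (λ ()) ∷ j⁻ᵃi-reduced (suc n)
... | no _  | no _  = record { word = [ k , Sign.+ ] ; reduced = [-] }

-- Subsets of ℤ are given by characteristic functions.
Convex : (ℤ → Bool) → Set
Convex I = ∀ {k l m} → k ℤ.≤ l → l ℤ.≤ m → T (I k) → T (I m) → T (I l)

_⊆_ : (ℤ → Bool) → (ℤ → Bool) → Set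
I ⊆ J = ∀ k → T (I k) → T (J k)

-- Σ_{k∈I} (x + k eⱼ , i*): at (y , l) the only summand that can be non-zero
-- is the one with k = yⱼ - xⱼ.
segment : ∀ {d} → Point d → Fin d → Fin d → (ℤ → Bool) → Stepped d
segment x j i I y l = if I k then face (x ⊕ k ⊙ e j) i y l else 0ℤ
  where k = Vec.lookup y j ℤ.- Vec.lookup x j

-- `Run 𝓑 j i` is the type of (eⱼ , i)-runs of 𝓑.
record Run {d} (𝓑 : Binary d) (j i : Fin d) : Set where
  open Binary 𝓑
  field
    base     : Point d
    interval : ℤ → Bool
    convex   : Convex interval
    nonZero  : ∃₂ λ y l → segment base j i interval y l ≢ 0ℤ
    below    : segment base j i interval ≼ fun
    maximal  : ∀ J → Convex J → segment base j i J ≼ fun →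
               interval ⊆ J → J ⊆ interval

HasLength : ∀ {d} {𝓑 : Binary d} {j i} → Run 𝓑 j i → ℕ → Set
HasLength R n = Fin n ↔ (Σ ℤ λ k → T (Run.interval R k))

-- `Admissible 𝓑 (i , j)` is the pair of conditions (1), (2) in the definition of T̃.
Admissible : ∀ {d} → Binary d → Fin d × Fin d → Set
Admissible 𝓑 (i , j) =
  i ≢ j ×
  (∀ k → k ≢ i → (∀ (R : Run 𝓑 i k) → HasLength R 1) ×
                 (k ≢ j → ∀ (R : Run 𝓑 j k) → HasLength R 1)) ×
  (∃₂ λ n (R : Run 𝓑 j i) → HasLength R n)

_<ₗₑₓ_ : ∀ {d} → Rel (Fin d × Fin d) 0ℓ
_<ₗₑₓ_ = ×-Lex _≡_ Fin._<_ Fin._<_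

Least : {A : Set} → Rel A 0ℓ → Pred A 0ℓ → Pred A 0ℓ
Least _<_ P x = P x × (∀ y → y < x → ¬ P y)

module _ (em : ExcludedMiddle 0ℓ) where

  abstract
    least : {A : Set} {_<_ : Rel A 0ℓ} → WellFounded _<_ →
            (P : Pred A 0ℓ) → ∃ P → ∃ (Least _<_ P)
    least {A} {_<_} wf P (x , px) = go x (wf x) px
      where
      go : ∀ x → Acc _<_ x → P x → ∃ (Least _<_ P)
      go x (acc rs) px with em {∃[ y ] y < x × P y}
      ... | yes (y , y<x , py) = go y (rs y<x) py
      ... | no none            = x , px , λ y y<x py → none (y , y<x , py)

  leastPair : ∀ {d} (P : Pred (Fin d × Fin d) 0ℓ) → ∃ P → ∃ (Least _<ₗₑₓ_ P)
  leastPair = least (×-wellFounded Fin.<-wellFounded Fin.<-wellFounded)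

  leastℕ : (P : Pred ℕ 0ℓ) → ∃ P → ∃ (Least ℕ._<_ P)
  leastℕ = least ℕ.<-wellFounded

  T̃Case : ∀ {d} → Binary d → Set
  T̃Case 𝓑 = ¬ ∃ (Admissible 𝓑) ⊎ ∃ (Least _<ₗₑₓ_ (Admissible 𝓑))

  t̃Case : ∀ {d} (𝓑 : Binary d) → T̃Case 𝓑
  t̃Case 𝓑 with em {∃ (Admissible 𝓑)}
  ... | yes exists = inj₂ (leastPair (Admissible 𝓑) exists)
  ... | no none    = inj₁ none

  RunOfLength : ∀ {d} → Binary d → Fin d → Fin d → Pred ℕ 0ℓ
  RunOfLength 𝓑 j i n = ∃[ R ] HasLength {𝓑 = 𝓑} {j} {i} R n

  T̃-by : ∀ {d} {𝓑 : Binary d} → T̃Case 𝓑 → Stepped d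
  T̃-by {𝓑 = 𝓑} (inj₁ _) = Binary.fun 𝓑
  T̃-by {𝓑 = 𝓑} (inj₂ ((i , j) , (i≢j , _ , finiteRun) , _)) =
    E₁* (β⁻¹ (proj₁ shortest) i j i≢j) (Binary.fun 𝓑)
    where
    shortest : ∃ (Least ℕ._<_ (RunOfLength 𝓑 j i))
    shortest = leastℕ (RunOfLength 𝓑 j i) finiteRun

  T̃ : ∀ {d} → Binary d → Stepped d
  T̃ 𝓑 = T̃-by (t̃Case 𝓑)

-- The identity matrix, except for the entries p, q, s, t at the positions
-- (i , i), (i , j), (j , i), (j , j).
block : ∀ {d} (i j : Fin d) (p q s t : ℤ) → Matrix d
block i j p q s t r c with r Fin.≟ i | r Fin.≟ j | c Fin.≟ i | c Fin.≟ j
... | yes _ | _     | yes _ | _     = p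
... | yes _ | _     | no _  | yes _ = q
... | no _  | yes _ | yes _ | _     = s
... | no _  | yes _ | no _  | yes _ = t
... | _     | _     | _     | _     = δ r c

brunMatrix : ∀ {d} → ℤ → Fin d → Fin d → Matrix d
brunMatrix a i j = block i j a 1ℤ 1ℤ 0ℤ

δ-refl : ∀ {d} (i : Fin d) → δ i i ≡ 1ℤ
δ-refl i with i Fin.≟ i
... | yes _  = refl
... | no i≢i = contradiction refl i≢i

δ-≢ : ∀ {d} {i j : Fin d} → i ≢ j → δ i j ≡ 0ℤ
δ-≢ {i = i} {j} i≢j with i Fin.≟ j
... | yes i≡j = contradiction i≡j i≢j
... | no _    = refl

δ-suc : ∀ {d} (i j : Fin d) → δ (suc i) (suc j) ≡ δ i j
δ-suc i j with i Fin.≟ j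
... | yes _ = refl
... | no _  = refl

sum-δ : ∀ {d} (i : Fin d) (v : Vector ℤ d) → sum (λ l → δ i l ℤ.* v l) ≡ v i
sum-δ {suc d} zero v = begin
  1ℤ ℤ.* v zero ℤ.+ sum (λ (l : Fin d) → 0ℤ ℤ.* v (suc l))
    ≡⟨ cong₂ ℤ._+_ (ℤ.*-identityˡ (v zero)) (trans (sum-cong-≗ λ l → ℤ.*-zeroˡ (v (suc l))) (sum-replicate-zero d)) ⟩
  v zero ℤ.+ 0ℤ ≡⟨ ℤ.+-identityʳ _ ⟩
  v zero        ∎
  where open ≡-Reasoning
sum-δ {suc d} (suc i) v = begin
  0ℤ ℤ.* v zero ℤ.+ sum (λ l → δ (suc i) (suc l) ℤ.* v (suc l))
    ≡⟨ cong₂ ℤ._+_ (ℤ.*-zeroˡ (v zero)) (sum-cong-≗ λ l → cong (ℤ._* v (suc l)) (δ-suc i l)) ⟩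
  0ℤ ℤ.+ sum (λ l → δ i l ℤ.* v (suc l)) ≡⟨ ℤ.+-identityˡ _ ⟩
  sum (λ l → δ i l ℤ.* v (suc l))        ≡⟨ sum-δ i (v ∘ suc) ⟩
  v (suc i)                              ∎
  where open ≡-Reasoning

sum-δ₂ : ∀ {d} (p q : ℤ) (i j : Fin d) (row v : Vector ℤ d) →
         (∀ l → row l ≡ p ℤ.* δ i l ℤ.+ q ℤ.* δ j l) →
         sum (λ l → row l ℤ.* v l) ≡ p ℤ.* v i ℤ.+ q ℤ.* v j
sum-δ₂ p q i j row v eq = begin
  sum (λ l → row l ℤ.* v l)
    ≡⟨ sum-cong-≗ (λ l → trans (cong (ℤ._* v l) (eq l)) (expand p q (δ i l) (δ j l) (v l))) ⟩
  sum (λ l → p ℤ.* (δ i l ℤ.* v l) ℤ.+ q ℤ.* (δ j l ℤ.* v l))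
    ≡⟨ ∑-distrib-+ (λ l → p ℤ.* (δ i l ℤ.* v l)) (λ l → q ℤ.* (δ j l ℤ.* v l)) ⟩
  sum (λ l → p ℤ.* (δ i l ℤ.* v l)) ℤ.+ sum (λ l → q ℤ.* (δ j l ℤ.* v l))
    ≡⟨ cong₂ ℤ._+_ (*-distribˡ-sum p (λ l → δ i l ℤ.* v l)) (*-distribˡ-sum q (λ l → δ j l ℤ.* v l)) ⟨
  p ℤ.* sum (λ l → δ i l ℤ.* v l) ℤ.+ q ℤ.* sum (λ l → δ j l ℤ.* v l)
    ≡⟨ cong₂ (λ m n → p ℤ.* m ℤ.+ q ℤ.* n) (sum-δ i v) (sum-δ j v) ⟩
  p ℤ.* v i ℤ.+ q ℤ.* v j ∎
  where
  open ≡-Reasoning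
  expand : ∀ p q x y z → (p ℤ.* x ℤ.+ q ℤ.* y) ℤ.* z ≡ p ℤ.* (x ℤ.* z) ℤ.+ q ℤ.* (y ℤ.* z)
  expand = ℤRing.solve-∀

module _ {d : ℕ} {i j : Fin d} (i≢j : i ≢ j) where

  private
    p+0 : ∀ p q → p ≡ p ℤ.* 1ℤ ℤ.+ q ℤ.* 0ℤ
    p+0 = ℤRing.solve-∀

    0+q : ∀ p q → q ≡ p ℤ.* 0ℤ ℤ.+ q ℤ.* 1ℤ
    0+q = ℤRing.solve-∀

    0+0 : ∀ p q → 0ℤ ≡ p ℤ.* 0ℤ ℤ.+ q ℤ.* 0ℤ
    0+0 = ℤRing.solve-∀

  module _ (p q s t : ℤ) where

    private
      M : Matrix d
      M = block i j p q s t

    block-ii : M i i ≡ p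
    block-ii with i Fin.≟ i
    ... | yes _  = refl
    ... | no i≢i = contradiction refl i≢i

    block-ij : M i j ≡ q
    block-ij with i Fin.≟ i | j Fin.≟ i | j Fin.≟ j
    ... | yes _  | no _    | yes _  = refl
    ... | yes _  | yes j≡i | _      = contradiction (sym j≡i) i≢j
    ... | no i≢i | _       | _      = contradiction refl i≢i
    ... | _      | _       | no j≢j = contradiction refl j≢j

    block-ji : M j i ≡ s
    block-ji with j Fin.≟ i | j Fin.≟ j | i Fin.≟ i
    ... | no _    | yes _  | yes _  = refl
    ... | yes j≡i | _      | _      = contradiction (sym j≡i) i≢j
    ... | _       | no j≢j | _      = contradiction refl j≢j
    ... | _       | _      | no i≢i = contradiction refl i≢i

    block-jj : M j j ≡ t
    block-jj with j Fin.≟ i | j Fin.≟ j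
    ... | no _    | yes _  = refl
    ... | yes j≡i | _      = contradiction (sym j≡i) i≢j
    ... | _       | no j≢j = contradiction refl j≢j

    block-row : ∀ {r} → r ≢ i → r ≢ j → ∀ c → M r c ≡ δ r c
    block-row {r} r≢i r≢j c with r Fin.≟ i | r Fin.≟ j
    ... | yes r≡i | _       = contradiction r≡i r≢i
    ... | no _    | yes r≡j = contradiction r≡j r≢j
    ... | no _    | no _    = refl

    block-column : ∀ {c} → c ≢ i → c ≢ j → ∀ r → M r c ≡ δ r c
    block-column {c} c≢i c≢j r with r Fin.≟ i | r Fin.≟ j | c Fin.≟ i | c Fin.≟ j
    ... | _     | _     | yes c≡i | _       = contradiction c≡i c≢i
    ... | _     | _     | no _    | yes c≡j = contradiction c≡j c≢j
    ... | yes _ | _     | no _    | no _    = refl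
    ... | no _  | yes _ | no _    | no _    = refl
    ... | no _  | no _  | no _    | no _    = refl

  combination : (p q : ℤ) (row : Vector ℤ d) → row i ≡ p → row j ≡ q →
                (∀ l → l ≢ i → l ≢ j → row l ≡ 0ℤ) →
                ∀ l → row l ≡ p ℤ.* δ i l ℤ.+ q ℤ.* δ j l
  combination p q row rowᵢ rowⱼ row₀ l = by (l Fin.≟ i) (l Fin.≟ j)
    where
    by : Dec (l ≡ i) → Dec (l ≡ j) → row l ≡ p ℤ.* δ i l ℤ.+ q ℤ.* δ j l
    by (yes refl) _ = trans (trans rowᵢ (p+0 p q))
      (sym (cong₂ (λ s t → p ℤ.* s ℤ.+ q ℤ.* t) (δ-refl i) (δ-≢ (i≢j ∘ sym))))
    by (no l≢i) (yes refl) = trans (trans rowⱼ (0+q p q))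
      (sym (cong₂ (λ s t → p ℤ.* s ℤ.+ q ℤ.* t) (δ-≢ (l≢i ∘ sym)) (δ-refl j)))
    by (no l≢i) (no l≢j) = trans (trans (row₀ l l≢i l≢j) (0+0 p q))
      (sym (cong₂ (λ s t → p ℤ.* s ℤ.+ q ℤ.* t) (δ-≢ (l≢i ∘ sym)) (δ-≢ (l≢j ∘ sym))))

  module _ (p q s t : ℤ) where

    private
      M : Matrix d
      M = block i j p q s t

    block-row-i : ∀ l → M i l ≡ p ℤ.* δ i l ℤ.+ q ℤ.* δ j l
    block-row-i = combination p q (M i) (block-ii p q s t) (block-ij p q s t)
      λ l l≢i l≢j → trans (block-column p q s t l≢i l≢j i) (δ-≢ (l≢i ∘ sym))

    block-row-j : ∀ l → M j l ≡ s ℤ.* δ i l ℤ.+ t ℤ.* δ j l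
    block-row-j = combination s t (M j) (block-ji p q s t) (block-jj p q s t)
      λ l l≢i l≢j → trans (block-column p q s t l≢i l≢j j) (δ-≢ (l≢j ∘ sym))

    block-product-i : ∀ v → sum (λ l → M i l ℤ.* v l) ≡ p ℤ.* v i ℤ.+ q ℤ.* v j
    block-product-i v = sum-δ₂ p q i j (M i) v block-row-i

    block-product-j : ∀ v → sum (λ l → M j l ℤ.* v l) ≡ s ℤ.* v i ℤ.+ t ℤ.* v j
    block-product-j v = sum-δ₂ s t i j (M j) v block-row-j

    block-product : ∀ {r} → r ≢ i → r ≢ j → ∀ v → sum (λ l → M r l ℤ.* v l) ≡ v r
    block-product {r} r≢i r≢j v =
      trans (sum-cong-≗ λ l → cong (ℤ._* v l) (block-row p q s t r≢i r≢j l)) (sum-δ r v)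

  block-inverse : ∀ p q s t p′ q′ s′ t′ →
    p ℤ.* p′ ℤ.+ q ℤ.* s′ ≡ 1ℤ → p ℤ.* q′ ℤ.+ q ℤ.* t′ ≡ 0ℤ →
    s ℤ.* p′ ℤ.+ t ℤ.* s′ ≡ 0ℤ → s ℤ.* q′ ℤ.+ t ℤ.* t′ ≡ 1ℤ →
    ∀ r c → (block i j p q s t ⊠ block i j p′ q′ s′ t′) r c ≡ δ r c
  block-inverse p q s t p′ q′ s′ t′ ii ij ji jj r c =
    by (r Fin.≟ i) (r Fin.≟ j) (c Fin.≟ i) (c Fin.≟ j)
    where
    N : Matrix d
    N = block i j p′ q′ s′ t′

    pair : ∀ x y {u u′ v v′ w} → u ≡ u′ → v ≡ v′ → x ℤ.* u′ ℤ.+ y ℤ.* v′ ≡ w →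
           x ℤ.* u ℤ.+ y ℤ.* v ≡ w
    pair x y refl refl eq = eq

    by : Dec (r ≡ i) → Dec (r ≡ j) → Dec (c ≡ i) → Dec (c ≡ j) →
         (block i j p q s t ⊠ N) r c ≡ δ r c
    by (yes refl) _ (yes refl) _ = trans (block-product-i p q s t λ l → N l i)
      (trans (pair p q (block-ii p′ q′ s′ t′) (block-ji p′ q′ s′ t′) ii) (sym (δ-refl i)))
    by (yes refl) _ (no c≢i) (yes refl) = trans (block-product-i p q s t λ l → N l j)
      (trans (pair p q (block-ij p′ q′ s′ t′) (block-jj p′ q′ s′ t′) ij) (sym (δ-≢ i≢j)))
    by (yes refl) _ (no c≢i) (no c≢j) = trans (block-product-i p q s t λ l → N l c)
      (trans (pair p q (column i) (column j)
               (trans (cong₂ (λ u v → p ℤ.* u ℤ.+ q ℤ.* v) (δ-≢ (c≢i ∘ sym)) (δ-≢ (c≢j ∘ sym)))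
                      (sym (0+0 p q))))
             (sym (δ-≢ (c≢i ∘ sym))))
      where column = block-column p′ q′ s′ t′ c≢i c≢j
    by (no r≢i) (yes refl) (yes refl) _ = trans (block-product-j p q s t λ l → N l i)
      (trans (pair s t (block-ii p′ q′ s′ t′) (block-ji p′ q′ s′ t′) ji) (sym (δ-≢ r≢i)))
    by (no r≢i) (yes refl) (no c≢i) (yes refl) = trans (block-product-j p q s t λ l → N l j)
      (trans (pair s t (block-ij p′ q′ s′ t′) (block-jj p′ q′ s′ t′) jj) (sym (δ-refl j)))
    by (no r≢i) (yes refl) (no c≢i) (no c≢j) = trans (block-product-j p q s t λ l → N l c)
      (trans (pair s t (column i) (column j)
               (trans (cong₂ (λ u v → s ℤ.* u ℤ.+ t ℤ.* v) (δ-≢ (c≢i ∘ sym)) (δ-≢ (c≢j ∘ sym)))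
                      (sym (0+0 s t))))
             (sym (δ-≢ (c≢j ∘ sym))))
      where column = block-column p′ q′ s′ t′ c≢i c≢j
    by (no r≢i) (no r≢j) _ _ = trans (block-product p q s t r≢i r≢j λ l → N l c)
      (block-row p′ q′ s′ t′ r≢i r≢j c)

  brunMatrix-invertible : ∀ a → ∃ (Inverses (brunMatrix a i j))
  brunMatrix-invertible a = block i j 0ℤ 1ℤ 1ℤ (ℤ.- a) ,
    block-inverse a 1ℤ 1ℤ 0ℤ 0ℤ 1ℤ 1ℤ (ℤ.- a) (ii a) (ij a) refl refl ,
    block-inverse 0ℤ 1ℤ 1ℤ (ℤ.- a) a 1ℤ 1ℤ 0ℤ refl refl (ji a) (jj a)
    where
    ii : ∀ a → a ℤ.* 0ℤ ℤ.+ 1ℤ ℤ.* 1ℤ ≡ 1ℤ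
    ii = ℤRing.solve-∀
    ij : ∀ a → a ℤ.* 1ℤ ℤ.+ 1ℤ ℤ.* (ℤ.- a) ≡ 0ℤ
    ij = ℤRing.solve-∀
    ji : ∀ a → 1ℤ ℤ.* a ℤ.+ (ℤ.- a) ℤ.* 1ℤ ≡ 0ℤ
    ji = ℤRing.solve-∀
    jj : ∀ a → 1ℤ ℤ.* 1ℤ ℤ.+ (ℤ.- a) ℤ.* 0ℤ ≡ 1ℤ
    jj = ℤRing.solve-∀

δ-inverse : ∀ {d} → Inverses {d} δ δ
δ-inverse = (λ r c → sum-δ r (λ l → δ l c)) , (λ r c → sum-δ r (λ l → δ l c))

private
  shift-suc : ∀ p q → (p ℤ.- q) ℤ.+ 1ℤ ≡ (1ℤ ℤ.+ p) ℤ.- q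
  shift-suc = ℤRing.solve-∀

  shift-cancel : ∀ p q → ((p ℤ.+ q) ℤ.- p) ℤ.+ 1ℤ ≡ 1ℤ ℤ.+ q
  shift-cancel = ℤRing.solve-∀

module _ (ℝ : Reals) where

  open Reals ℝ

  ⟨_∣_⟩ : ∀ {d} → Point d → Vector Carrier d → Carrier
  ⟨ x ∣ α ⟩ = ∑ λ i → ι (Vec.lookup x i) * α i

  𝓟 : ∀ {d} → Vector Carrier d → Carrier → Binary d
  𝓟 α ρ = record { fun = value ; binary = value-binary }
    where
    inside? : ∀ x i → Dec (⟨ x ∣ α ⟩ < ρ × ρ ≤ ⟨ x ⊕ e i ∣ α ⟩)
    inside? x i = (⟨ x ∣ α ⟩ <? ρ) ×-dec (ρ ≤? ⟨ x ⊕ e i ∣ α ⟩)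

    value : Stepped _
    value x i = if does (inside? x i) then 1ℤ else 0ℤ

    value-binary : ∀ x i → value x i ≡ 0ℤ ⊎ value x i ≡ 1ℤ
    value-binary x i with does (inside? x i)
    ... | true  = inj₂ refl
    ... | false = inj₁ refl

  X X₀ : ∀ {d} → Pred (Vector Carrier d) 0ℓ
  X  α = (∀ i → 0# ≤ α i) × ¬ (∀ i → α i ≈ 0#)
  X₀ α = ∃₂ λ l i → 0# < l × (∀ k → α k ≈ l * ι (δ i k))

  MaxPair : ∀ {d} → Vector Carrier d → Pred (Fin d × Fin d) 0ℓ
  MaxPair α (i , j) = i ≢ j × (∀ k → α k ≤ α i) × (∀ k → k ≢ i → α k ≤ α j)

  argmax : ∀ {n} (f : Vector Carrier (suc n)) → ∃[ i ] ∀ k → f k ≤ f i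
  argmax {zero}  f = zero , λ { zero → ≤-refl }
  argmax {suc n} f with argmax (f ∘ suc)
  ... | i , max with total (f zero) (f (suc i))
  ...   | inj₁ f0≤fi = suc i , λ { zero → f0≤fi ; (suc k) → max k }
  ...   | inj₂ fi≤f0 = zero  , λ { zero → ≤-refl ; (suc k) → ≤-trans (max k) fi≤f0 }

  abstract
    maxPair : ∀ {d} → 3 ℕ.≤ d → (α : Vector Carrier d) → ∃ (MaxPair α)
    maxPair (s≤s (s≤s _)) α with argmax α
    ... | i , maxᵢ with argmax (α ∘ punchIn i)
    ...   | j , maxⱼ = (i , punchIn i j) , (Fin.punchInᵢ≢i i j ∘ sym) , maxᵢ ,
      λ k k≢i → subst (λ l → α l ≤ α (punchIn i j)) (Fin.punchIn-punchOut (k≢i ∘ sym))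
                      (maxⱼ (punchOut (k≢i ∘ sym)))

module _ (em : ExcludedMiddle 0ℓ) (ℝ : Reals) where

  open Reals ℝ
  private
    module R = CommutativeRing commutativeRing
    module RP = RingProperties ring
    module O = IsStrictTotalOrder isStrictTotalOrder

    ≤-<-trans : ∀ {x y z} → x ≤ y → y < z → x < z
    ≤-<-trans = StrictToNonStrict.≤-<-trans _≈_ _<_ R.sym O.trans O.<-respˡ-≈

    ≮⇒≥ : ∀ {x y} → ¬ x < y → y ≤ x
    ≮⇒≥ {x} {y} x≮y with compare x y
    ... | tri< x<y _ _ = contradiction x<y x≮y
    ... | tri≈ _ x≈y _ = inj₂ (R.sym x≈y)
    ... | tri> _ _ y<x = inj₁ y<x

    +-monoʳ-≤ : ∀ z {x y} → x ≤ y → z + x ≤ z + y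
    +-monoʳ-≤ z (inj₁ x<y) = inj₁ (+-monoʳ-< z x<y)
    +-monoʳ-≤ z (inj₂ x≈y) = inj₂ (R.+-congˡ x≈y)

    -x+[x+y]≈y : ∀ x y → - x + (x + y) ≈ y
    -x+[x+y]≈y x y = R.trans (R.sym (R.+-assoc (- x) x y))
      (R.trans (R.+-congʳ (R.-‿inverseˡ x)) (R.+-identityˡ y))

    neg-swap : ∀ {x y} → - x < y → - y < x
    neg-swap {x} {y} -x<y =
      O.<-respʳ-≈ (R.trans (R.+-congˡ (R.+-comm x y)) (-x+[x+y]≈y y x))
        (O.<-respˡ-≈ (R.trans (R.+-congˡ (R.-‿inverseʳ x)) (R.+-identityʳ (- y)))
          (+-monoʳ-< (- y) (+-monoʳ-< x -x<y)))

    natural : Pred Carrier 0ℓ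
    natural y = ∃[ n ] y ≈ ι (+ n)

    no-supremum : ∀ s → (∀ y → natural y → y ≤ s) →
                  ¬ (∀ b → (∀ y → natural y → y ≤ b) → s ≤ b)
    no-supremum s bound least = O.irrefl {s} R.refl (≤-<-trans s≤-1+s -1+s<s)
      where
      -1+s-bound : ∀ y → natural y → y ≤ - 1# + s
      -1+s-bound y (n , y≈n) =
        ≤-trans (inj₂ (R.trans y≈n (R.sym (-x+[x+y]≈y 1# (ι (+ n))))))
                (+-monoʳ-≤ (- 1#) (bound (1# + ι (+ n)) (suc n , R.refl)))

      s≤-1+s : s ≤ - 1# + s
      s≤-1+s = least (- 1# + s) -1+s-bound

      s<1+s : s < 1# + s
      s<1+s = O.<-respʳ-≈ (R.+-comm s 1#) (O.<-respˡ-≈ (R.+-identityʳ s) (+-monoʳ-< s 0<1))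

      -1+s<s : - 1# + s < s
      -1+s<s = O.<-respʳ-≈ (-x+[x+y]≈y 1# s) (+-monoʳ-< (- 1#) s<1+s)

  archimedean : ∀ x → ∃[ n ] x < ι (+ n)
  archimedean x = by em
    where
    by : Dec (∃[ n ] x < ι (+ n)) → ∃[ n ] x < ι (+ n)
    by (yes found) = found
    by (no none)
      with s , bound , least ← complete natural (0# , 0 , R.refl)
             (x , λ y (n , y≈n) → ≤-trans (inj₂ y≈n) (≮⇒≥ λ x<n → none (n , x<n)))
      = ⊥-elim (no-supremum s bound least)

  private
    offset : ℕ → ℕ → ℤ
    offset N n = + n ℤ.- + N

    ι-neg : ∀ n → ι (ℤ.- + n) ≈ - ι (+ n)
    ι-neg zero    = R.sym RP.-0#≈0#
    ι-neg (suc n) = R.refl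

    ι-offset-0 : ∀ N → ι (offset N 0) ≈ - ι (+ N)
    ι-offset-0 N = R.trans (R.reflexive (cong ι (ℤ.+-identityˡ (ℤ.- + N)))) (ι-neg N)

    integerPart-by : ∀ x N → - x < ι (+ N) →
                     ∃ (Least ℕ._<_ (λ n → x < ι (offset N n ℤ.+ 1ℤ))) →
                     ∃[ k ] ι k ≤ x × x < ι (k ℤ.+ 1ℤ)
    integerPart-by x N -x<N (zero , x<k+1 , _) =
      offset N 0 , inj₁ (O.<-respˡ-≈ (R.sym (ι-offset-0 N)) (neg-swap -x<N)) , x<k+1
    integerPart-by x N -x<N (suc n , x<k+1 , min) =
      offset N (suc n) ,
      subst (λ z → ι z ≤ x) (shift-suc (+ n) (+ N)) (≮⇒≥ (min n (ℕ.n<1+n n))) ,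
      x<k+1

    x<offset : ∀ x N M → x < ι (+ M) → x < ι (offset N (N ℕ.+ M) ℤ.+ 1ℤ)
    x<offset x N M x<M = subst (λ z → x < ι z) (sym (shift-cancel (+ N) (+ M)))
      (O.trans x<M (O.<-respʳ-≈ (R.+-comm (ι (+ M)) 1#)
        (O.<-respˡ-≈ (R.+-identityʳ (ι (+ M))) (+-monoʳ-< (ι (+ M)) 0<1))))

  abstract
    integerPart : ∀ x → ∃[ k ] ι k ≤ x × x < ι (k ℤ.+ 1ℤ)
    integerPart x = by (archimedean (- x)) (archimedean x)
      where
      by : (∃[ N ] - x < ι (+ N)) → (∃[ M ] x < ι (+ M)) →
           ∃[ k ] ι k ≤ x × x < ι (k ℤ.+ 1ℤ)
      by (N , -x<N) (M , x<M) = integerPart-by x N -x<N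
        (leastℕ em (λ n → x < ι (offset N n ℤ.+ 1ℤ)) (N ℕ.+ M , x<offset x N M x<M))

  ⌊_⌋ : Carrier → ℤ
  ⌊ x ⌋ = proj₁ (integerPart x)

  module _ {d : ℕ} (3≤d : 3 ℕ.≤ d) where

    BrunCase : Vector Carrier d → Set
    BrunCase α = X₀ ℝ α ⊎ ∃ (Least _<ₗₑₓ_ (MaxPair ℝ α))

    brunCase : ∀ α → BrunCase α
    brunCase α with em {X₀ ℝ α}
    ... | yes α∈X₀ = inj₁ α∈X₀
    ... | no _     = inj₂ (leastPair em (MaxPair ℝ α) (maxPair ℝ 3≤d α))

    B-by : ∀ {α} → BrunCase α → Matrix d
    B-by     (inj₁ _)             = δ
    B-by {α} (inj₂ ((i , j) , _)) = brunMatrix ⌊ α i * α j ⁻¹ ⌋ i j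

    B : Vector Carrier d → Matrix d
    B α = B-by (brunCase α)

    B-by-invertible : ∀ {α} (c : BrunCase α) → ∃ (Inverses (B-by c))
    B-by-invertible     (inj₁ _) = δ , δ-inverse
    B-by-invertible {α} (inj₂ ((i , j) , (i≢j , _) , _)) =
      brunMatrix-invertible i≢j ⌊ α i * α j ⁻¹ ⌋

    B⁻¹ : Vector Carrier d → Matrix d
    B⁻¹ α = proj₁ (B-by-invertible (brunCase α))

    B-B⁻¹-inverses : ∀ α → Inverses (B α) (B⁻¹ α)
    B-B⁻¹-inverses α = proj₂ (B-by-invertible (brunCase α))

    brunMap : Vector Carrier d → Vector Carrier d
    brunMap α r = ∑ λ c → ι (B⁻¹ α r c) * α c

{-# OPTIONS --safe #-}

-- Let [s < ρ] be 1 if s < ρ and 0 otherwise.  For α ≥ 0 the plane takes the value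
-- [⟨x∣α⟩ < ρ] - [⟨x∣α⟩ + αᵢ < ρ] at (x , i), so that the sum over the letters of σ(i)
-- in the dual map telescopes: E₁*(σ) sends the plane of normal vector α to the one of
-- normal vector ᵗM_σ α whenever the latter is non-negative.  For σ = β⁻¹ this vector is
-- the image of α under the Brun map.
--
-- If αⱼ > 0, let K(c) be the least integer k with ρ ≤ c + k αⱼ.  The (eⱼ , i)-run through
-- the points x + k eⱼ is given by K(⟨x∣α⟩ + αᵢ) ≤ k < K(⟨x∣α⟩), and over x = m eᵢ with
-- m = 0, 1, … the differences of these bounds telescope, so that αᵢ / αⱼ is the average
-- length.  Hence all lengths are at most 1 if and only if αᵢ ≤ αⱼ, and for αⱼ ≤ αᵢ the
-- shortest length is ⌊αᵢ / αⱼ⌋.  If αⱼ = 0, all runs are infinite.  Therefore the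
-- admissible pairs are exactly the pairs of positions of the two largest entries,
-- provided that the second one is positive.
module Submission where

open import Defs
open import Level using (0ℓ)
open import Data.Nat.Base as ℕ using (ℕ; zero; suc)
import Data.Nat.Properties as ℕ
open import Data.Integer.Base as ℤ using (ℤ; +_; -[1+_]; 0ℤ; 1ℤ)
import Data.Integer.Properties as ℤ
import Data.Integer.Tactic.RingSolver as ℤRing
open import Data.Bool.Base using (Bool; true; false; T; if_then_else_; _∧_)
open import Data.Bool.Properties using (T-irrelevant)
open import Data.Sign.Base as Sign using (Sign)
open import Data.Fin.Base as Fin using (Fin; zero; suc; toℕ)
import Data.Fin.Properties as Fin
open import Data.Fin.Permutation using (↔⇒≡)
open import Data.List.Base as List using (List; []; _∷_)
import Data.Vec.Base as Vec
import Data.Vec.Properties as Vec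
open import Data.Vec.Functional using (Vector)
open import Data.Product.Base using (Σ; ∃; ∃₂; ∃-syntax; _×_; _,_; proj₁; proj₂)
open import Data.Product.Relation.Binary.Lex.Strict using (×-compare)
open import Data.Sum.Base using (inj₁; inj₂; [_,_]′)
import Data.Maybe.Base as Maybe
open import Function.Base using (_∘_)
open import Function.Bundles using (_↔_; Inverse; mk↔ₛ′)
open import Function.Properties.Inverse using (↔-sym; ↔-trans)
open import Relation.Nullary using (¬_; Dec; yes; no; does; _×-dec_; contradiction)
open import Relation.Nullary.Decidable using (dec⇒maybe; dec-true; isYes; toWitness; fromWitness)
open import Relation.Unary using (Pred)
open import Relation.Binary.Definitions using (tri<; tri≈; tri>)
open import Relation.Binary.Structures using (IsStrictTotalOrder)
import Relation.Binary.Construct.StrictToNonStrict as StrictToNonStrict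
open import Relation.Binary.PropositionalEquality as ≡ using (_≡_; _≢_; refl)
open import Algebra.Bundles using (CommutativeRing)
import Algebra.Properties.Ring as RingProperties
import Algebra.Properties.Semiring.Mult as Mult
import Algebra.Properties.Semiring.Sum as Sum
open import Algebra.Properties.Semiring.Sum ℤ.+-*-semiring using (sum; sum-cong-≗)
import Algebra.Solver.Ring as Solver
open import Algebra.Solver.Ring.AlmostCommutativeRing
  using (fromCommutativeRing; _-Raw-AlmostCommutative⟶_)
open import Axiom.ExcludedMiddle using (ExcludedMiddle)

open FreeGroup using (word)

-- Ordered-field arithmetic and the embedding of the integers.

module Arithmetic (ℝ : Reals) where

  open Reals ℝ
  module R = CommutativeRing commutativeRing
  module O = IsStrictTotalOrder isStrictTotalOrder
  open RingProperties ring using (-0#≈0#; -‿distribˡ-*; -‿involutive; -‿+-comm)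
  open Mult R.semiring using (×-homo-+)
  open import Relation.Binary.Reasoning.Setoid R.setoid

  ι-neg : ∀ k → ι (ℤ.- k) ≈ - ι k
  ι-neg (+ zero)  = R.sym -0#≈0#
  ι-neg (+ suc n) = R.refl
  ι-neg -[1+ n ]  = R.sym (-‿involutive _)

  ι-⊖ : ∀ m n → ι (m ℤ.⊖ n) ≈ ι (+ m) + - ι (+ n)
  ι-⊖ m zero = R.sym (R.trans (R.+-congˡ -0#≈0#) (R.+-identityʳ _))
  ι-⊖ zero (suc n) = R.sym (R.+-identityˡ _)
  ι-⊖ (suc m) (suc n) = begin
    ι (suc m ℤ.⊖ suc n)                            ≡⟨ ≡.cong ι (ℤ.[1+m]⊖[1+n]≡m⊖n m n) ⟩
    ι (m ℤ.⊖ n)                                    ≈⟨ ι-⊖ m n ⟩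
    ι (+ m) + - ι (+ n)                          ≈⟨ R.+-congʳ (R.+-identityʳ _) ⟨
    (ι (+ m) + 0#) + - ι (+ n)                   ≈⟨ R.+-congʳ (R.+-congˡ (R.-‿inverseʳ 1#)) ⟨
    (ι (+ m) + (1# + - 1#)) + - ι (+ n)          ≈⟨ R.+-congʳ (R.+-assoc _ _ _) ⟨
    ((ι (+ m) + 1#) + - 1#) + - ι (+ n)          ≈⟨ R.+-assoc _ _ _ ⟩
    (ι (+ m) + 1#) + (- 1# + - ι (+ n))          ≈⟨ R.+-cong (R.+-comm _ _) (-‿+-comm _ _) ⟩
    ι (+ suc m) + - ι (+ suc n)                  ∎

  ι-+ : ∀ k l → ι (k ℤ.+ l) ≈ ι k + ι l
  ι-+ (+ m)    (+ n)    = ×-homo-+ 1# m n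
  ι-+ (+ m)    -[1+ n ] = ι-⊖ m (suc n)
  ι-+ -[1+ m ] (+ n)    = R.trans (ι-⊖ n (suc m)) (R.+-comm _ _)
  ι-+ -[1+ m ] -[1+ n ] = begin
    - ι (+ suc (suc (m ℕ.+ n)))    ≡⟨ ≡.cong (λ l → - ι (+ suc l)) (ℕ.+-suc m n) ⟨
    - ι (+ (suc m ℕ.+ suc n))      ≈⟨ R.-‿cong (×-homo-+ 1# (suc m) (suc n)) ⟩
    - (ι (+ suc m) + ι (+ suc n))  ≈⟨ -‿+-comm _ _ ⟨
    - ι (+ suc m) + - ι (+ suc n)  ∎

  ι-*ℕ : ∀ m k → ι (+ m ℤ.* k) ≈ ι (+ m) * ι k
  ι-*ℕ zero    k = R.trans (R.reflexive (≡.cong ι (ℤ.*-zeroˡ k))) (R.sym (R.zeroˡ _))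
  ι-*ℕ (suc m) k = begin
    ι (+ suc m ℤ.* k)        ≡⟨ ≡.cong ι (ℤ.suc-* (+ m) k) ⟩
    ι (k ℤ.+ + m ℤ.* k)      ≈⟨ ι-+ k _ ⟩
    ι k + ι (+ m ℤ.* k)      ≈⟨ R.+-cong (R.sym (R.*-identityˡ _)) (ι-*ℕ m k) ⟩
    1# * ι k + ι (+ m) * ι k ≈⟨ R.distribʳ _ _ _ ⟨
    ι (+ suc m) * ι k        ∎

  ι-* : ∀ k l → ι (k ℤ.* l) ≈ ι k * ι l
  ι-* (+ m)    l = ι-*ℕ m l
  ι-* -[1+ m ] l = begin
    ι (-[1+ m ] ℤ.* l)        ≡⟨ ≡.cong ι (ℤ.neg-distribˡ-* (+ suc m) l) ⟨
    ι (ℤ.- (+ suc m ℤ.* l))   ≈⟨ ι-neg (+ suc m ℤ.* l) ⟩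
    - ι (+ suc m ℤ.* l)       ≈⟨ R.-‿cong (ι-*ℕ (suc m) l) ⟩
    - (ι (+ suc m) * ι l)     ≈⟨ -‿distribˡ-* _ _ ⟩
    - ι (+ suc m) * ι l       ∎

  ι-1 : ι 1ℤ ≈ 1#
  ι-1 = R.+-identityʳ 1#

  -- Makes the integers the coefficients of the ring solver. There `con k` denotes `ι k`; in
  -- particular `con 1ℤ` is `1# + 0#`, and `ι-1` converts it to `1#`.
  ι-homomorphism : ℤ.+-*-rawRing -Raw-AlmostCommutative⟶ fromCommutativeRing commutativeRing
  ι-homomorphism = record
    { ⟦_⟧ = ι ; +-homo = ι-+ ; *-homo = ι-* ; -‿homo = ι-neg ; 0-homo = R.refl ; 1-homo = ι-1 }

  open Solver ℤ.+-*-rawRing (fromCommutativeRing commutativeRing) ι-homomorphism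
    (λ k l → Maybe.map (R.reflexive ∘ ≡.cong ι) (dec⇒maybe (k ℤ.≟ l))) public
    using (solve; _:=_; _:+_; _:*_; :-_; _:-_; con)

  <-≤-trans : ∀ {x y z} → x < y → y ≤ z → x < z
  <-≤-trans = StrictToNonStrict.<-≤-trans _≈_ _<_ O.trans O.<-respʳ-≈

  ≤-<-trans : ∀ {x y z} → x ≤ y → y < z → x < z
  ≤-<-trans = StrictToNonStrict.≤-<-trans _≈_ _<_ R.sym O.trans O.<-respˡ-≈

  ≤-respʳ-≈ : ∀ {x y z} → y ≈ z → x ≤ y → x ≤ z
  ≤-respʳ-≈ = StrictToNonStrict.≤-respʳ-≈ _≈_ _<_ R.trans O.<-respʳ-≈

  ≤-respˡ-≈ : ∀ {x y z} → y ≈ z → y ≤ x → z ≤ x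
  ≤-respˡ-≈ = StrictToNonStrict.≤-respˡ-≈ _≈_ _<_ R.sym R.trans O.<-respˡ-≈

  ≤⇒≯ : ∀ {x y} → x ≤ y → ¬ y < x
  ≤⇒≯ x≤y y<x = O.irrefl R.refl (≤-<-trans x≤y y<x)

  ≮⇒≥ : ∀ {x y} → ¬ x < y → y ≤ x
  ≮⇒≥ {x} {y} x≮y with compare x y
  ... | tri< x<y _ _ = contradiction x<y x≮y
  ... | tri≈ _ x≈y _ = inj₂ (R.sym x≈y)
  ... | tri> _ _ y<x = inj₁ y<x

  ≤-antisym : ∀ {x y} → x ≤ y → y ≤ x → x ≈ y
  ≤-antisym (inj₂ x≈y) _    = x≈y
  ≤-antisym (inj₁ x<y) y≤x = contradiction x<y (≤⇒≯ y≤x)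

  ≤∧≉⇒< : ∀ {x y} → x ≤ y → ¬ x ≈ y → x < y
  ≤∧≉⇒< (inj₁ x<y) _   = x<y
  ≤∧≉⇒< (inj₂ x≈y) x≉y = contradiction x≈y x≉y

  +-monoʳ-≤ : ∀ z {x y} → x ≤ y → z + x ≤ z + y
  +-monoʳ-≤ z (inj₁ x<y) = inj₁ (+-monoʳ-< z x<y)
  +-monoʳ-≤ z (inj₂ x≈y) = inj₂ (R.+-congˡ x≈y)

  +-mono-<-≤ : ∀ {x y z w} → x < y → z ≤ w → x + z < y + w
  +-mono-<-≤ {x} {y} {z} {w} x<y z≤w = <-≤-trans
    (O.<-respˡ-≈ (R.+-comm z x) (O.<-respʳ-≈ (R.+-comm z y) (+-monoʳ-< z x<y))) (+-monoʳ-≤ y z≤w)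

  +-mono-≤ : ∀ {x y z w} → x ≤ y → z ≤ w → x + z ≤ y + w
  +-mono-≤ {x} {y} {z} {w} x≤y z≤w = ≤-trans
    (≤-respˡ-≈ (R.+-comm z x) (≤-respʳ-≈ (R.+-comm z y) (+-monoʳ-≤ z x≤y))) (+-monoʳ-≤ y z≤w)

  -- b - a ≈ d - c, with the subtrahends moved so that no subtraction occurs.
  shift-< : ∀ {a b c d} → c < d → a + d ≈ b + c → a < b
  shift-< {a} {b} {c} {d} c<d eq = O.<-respˡ-≈ (solve 2 (λ a c → (a :- c) :+ c := a) R.refl a c)
    (O.<-respʳ-≈ (begin
      (a + - c) + d ≈⟨ solve 3 (λ a c d → (a :- c) :+ d := (a :+ d) :- c) R.refl a c d ⟩
      (a + d) + - c ≈⟨ R.+-congʳ eq ⟩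
      (b + c) + - c ≈⟨ solve 2 (λ b c → (b :+ c) :- c := b) R.refl b c ⟩
      b             ∎)
    (+-monoʳ-< (a + - c) c<d))

  shift-≤ : ∀ {a b c d} → c ≤ d → a + d ≈ b + c → a ≤ b
  shift-≤ (inj₁ c<d) eq = inj₁ (shift-< c<d eq)
  shift-≤ {a} {b} {c} {d} (inj₂ c≈d) eq = inj₂ (begin
    a             ≈⟨ solve 2 (λ a c → a := (a :+ c) :- c) R.refl a c ⟩
    (a + c) + - c ≈⟨ R.+-congʳ (R.trans (R.+-congˡ c≈d) eq) ⟩
    (b + c) + - c ≈⟨ solve 2 (λ b c → (b :+ c) :- c := b) R.refl b c ⟩
    b             ∎)

  *-monoʳ-< : ∀ {u x y} → 0# < u → x < y → x * u < y * u
  *-monoʳ-< {u} {x} {y} 0<u x<y = shift-< (*-pos (shift-< {0#} {y + - x} x<y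
      (solve 2 (λ x y → con 0ℤ :+ y := (y :- x) :+ x) R.refl x y)) 0<u)
    (solve 3 (λ x y u → x :* u :+ (y :- x) :* u := y :* u :+ con 0ℤ) R.refl x y u)

  *-monoʳ-≤ : ∀ {u x y} → 0# ≤ u → x ≤ y → x * u ≤ y * u
  *-monoʳ-≤ _          (inj₂ x≈y) = inj₂ (R.*-congʳ x≈y)
  *-monoʳ-≤ (inj₁ 0<u) (inj₁ x<y) = inj₁ (*-monoʳ-< 0<u x<y)
  *-monoʳ-≤ (inj₂ 0≈u) (inj₁ _)   = inj₂ (R.trans (vanish _) (R.sym (vanish _)))
    where
    vanish : ∀ x → x * _ ≈ 0#
    vanish x = R.trans (R.*-congˡ (R.sym 0≈u)) (R.zeroʳ x)

  *-cancelʳ-< : ∀ {u x y} → 0# < u → x * u < y * u → x < y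
  *-cancelʳ-< {u} {x} {y} 0<u xu<yu with y ≤? x
  ... | yes y≤x = contradiction xu<yu (≤⇒≯ (*-monoʳ-≤ (inj₁ 0<u) y≤x))
  ... | no  y≰x = [ (λ x≤y → ≤∧≉⇒< x≤y (λ x≈y → y≰x (inj₂ (R.sym x≈y))))
                  , (λ y≤x → contradiction y≤x y≰x) ]′ (total x y)

  0≤ι : ∀ n → 0# ≤ ι (+ n)
  0≤ι zero    = inj₂ R.refl
  0≤ι (suc n) = ≤-respˡ-≈ (R.+-identityʳ 0#) (+-mono-≤ (inj₁ 0<1) (0≤ι n))

  ι-mono-≤ : ∀ {k l} → k ℤ.≤ l → ι k ≤ ι l
  ι-mono-≤ {k} {l} k≤l = shift-≤ (0≤ι ℤ.∣ l ℤ.- k ∣) (begin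
    ι k + ι (+ ℤ.∣ l ℤ.- k ∣)  ≡⟨ ≡.cong (λ n → ι k + ι n) (ℤ.0≤i⇒+∣i∣≡i (ℤ.i≤j⇒0≤j-i k≤l)) ⟩
    ι k + ι (l ℤ.- k)          ≈⟨ R.+-congˡ (R.trans (ι-+ l _) (R.+-congˡ (ι-neg k))) ⟩
    ι k + (ι l + - ι k)        ≈⟨ solve 2 (λ k l → k :+ (l :- k) := l :+ con 0ℤ) R.refl (ι k) (ι l) ⟩
    ι l + 0#                   ∎)

  ι-cancel-< : ∀ {k l} → ι k < ι l → k ℤ.< l
  ι-cancel-< ιk<ιl = ℤ.≰⇒> λ l≤k → ≤⇒≯ (ι-mono-≤ l≤k) ιk<ιl

-- Coordinates of points and summands of the dual map.

lookup-⊕ : ∀ {d} (x y : Point d) i → Vec.lookup (x ⊕ y) i ≡ Vec.lookup x i ℤ.+ Vec.lookup y i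
lookup-⊕ x y i = Vec.lookup-zipWith ℤ._+_ i x y

lookup-⊖ : ∀ {d} (x y : Point d) i → Vec.lookup (x ⊖ y) i ≡ Vec.lookup x i ℤ.- Vec.lookup y i
lookup-⊖ x y i = Vec.lookup-zipWith ℤ._-_ i x y

lookup-⊙ : ∀ {d} k (x : Point d) i → Vec.lookup (k ⊙ x) i ≡ k ℤ.* Vec.lookup x i
lookup-⊙ k x i = Vec.lookup-map i (k ℤ.*_) x

lookup-e : ∀ {d} (i l : Fin d) → Vec.lookup (e i) l ≡ δ i l
lookup-e i l = Vec.lookup∘tabulate (δ i) l

occurrence : ∀ {d} → Stepped d → Letter d → Point d → ℤ
occurrence E (j , Sign.+) y = E y j
occurrence E (j , Sign.-) y = ℤ.- E (y ⊖ e j) j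

-- The summands of E₁* are given by a local function that has no name here:
-- unification with the unfolding of E₁* determines the left-hand side of the second type.
E₁*-occurrences : ∀ {d} (σ : Endo d) E x i → E₁* σ E x i ≡
  sum (λ k → occurrence E (List.lookup (word (σ i)) k)
                        (incidence σ · x ⊕ abelianize (List.take (toℕ k) (word (σ i)))))
summand-occurrence : ∀ {d} (σ : Endo d) E x i k → _ ≡
  occurrence E (List.lookup (word (σ i)) k)
               (incidence σ · x ⊕ abelianize (List.take (toℕ k) (word (σ i))))
E₁*-occurrences σ E x i = sum-cong-≗ (summand-occurrence σ E x i)
summand-occurrence σ E x i k
  with List.lookup (word (σ i)) k | incidence σ · x ⊕ abelianize (List.take (toℕ k) (word (σ i)))
... | j , Sign.+ | y = refl
... | j , Sign.- | y = refl

-- Scalar products and the dual map on stepped planes.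

module Planes (ℝ : Reals) where

  open Arithmetic ℝ
  open Reals ℝ
  open Sum R.semiring using (*-distribˡ-sum; *-distribʳ-sum; ∑-distrib-+; ∑-comm)
    renaming (sum-cong-≋ to ∑-cong; sum-replicate-zero to ∑-zero)
  open import Relation.Binary.Reasoning.Setoid R.setoid

  infix 8 _∙_

  _∙_ : ∀ {d} → Point d → Vector Carrier d → Carrier
  x ∙ α = ⟨_∣_⟩ ℝ x α

  ∙-congˡ : ∀ {d} {α β : Vector Carrier d} → (∀ i → α i ≈ β i) → ∀ x → x ∙ α ≈ x ∙ β
  ∙-congˡ α≈β x = ∑-cong λ i → R.*-congˡ (α≈β i)

  ∙-congʳ : ∀ {d} (α : Vector Carrier d) (x y : Point d) →
            (∀ i → Vec.lookup x i ≡ Vec.lookup y i) → x ∙ α ≈ y ∙ α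
  ∙-congʳ α x y x≗y = ∑-cong λ i → R.*-congʳ (R.reflexive (≡.cong ι (x≗y i)))

  ⊕-∙ : ∀ {d} (α : Vector Carrier d) x y → (x ⊕ y) ∙ α ≈ x ∙ α + y ∙ α
  ⊕-∙ α x y = R.trans
    (∑-cong λ i → R.trans (R.*-congʳ (R.trans (R.reflexive (≡.cong ι (lookup-⊕ x y i)))
                                                (ι-+ (Vec.lookup x i) (Vec.lookup y i))))
                          (R.distribʳ _ _ _))
    (∑-distrib-+ (λ i → ι (Vec.lookup x i) * α i) (λ i → ι (Vec.lookup y i) * α i))

  ⊙-∙ : ∀ {d} (α : Vector Carrier d) k x → (k ⊙ x) ∙ α ≈ ι k * x ∙ α
  ⊙-∙ α k x = R.trans
    (∑-cong λ i → R.trans (R.*-congʳ (R.trans (R.reflexive (≡.cong ι (lookup-⊙ k x i)))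
                                                (ι-* k (Vec.lookup x i))))
                          (R.*-assoc _ _ _))
    (R.sym (*-distribˡ-sum (ι k) (λ i → ι (Vec.lookup x i) * α i)))

  ⊖-∙ : ∀ {d} (α : Vector Carrier d) x y → (x ⊖ y) ∙ α + y ∙ α ≈ x ∙ α
  ⊖-∙ α x y = R.trans (R.sym (⊕-∙ α (x ⊖ y) y)) (∙-congʳ α (x ⊖ y ⊕ y) x λ i →
    ≡.trans (lookup-⊕ (x ⊖ y) y i) (≡.trans
      (≡.cong (ℤ._+ Vec.lookup y i) (lookup-⊖ x y i)) (cancel (Vec.lookup x i) (Vec.lookup y i))))
    where
    cancel : ∀ k l → (k ℤ.- l) ℤ.+ l ≡ k
    cancel = ℤRing.solve-∀

  ∑-δ : ∀ {d} (i : Fin d) (v : Vector Carrier d) → ∑ (λ l → ι (δ i l) * v l) ≈ v i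
  ∑-δ {suc d} zero v = begin
    ι 1ℤ * v zero + ∑ (λ l → 0# * v (suc l))
      ≈⟨ R.+-cong (R.*-congʳ ι-1) (R.trans (∑-cong λ l → R.zeroˡ (v (suc l))) (∑-zero d)) ⟩
    1# * v zero + 0# ≈⟨ R.+-identityʳ _ ⟩
    1# * v zero      ≈⟨ R.*-identityˡ _ ⟩
    v zero           ∎
  ∑-δ {suc d} (suc i) v = begin
    0# * v zero + ∑ (λ l → ι (δ (suc i) (suc l)) * v (suc l))
      ≈⟨ R.+-cong (R.zeroˡ _) (∑-cong λ l → R.*-congʳ (R.reflexive (≡.cong ι (δ-suc i l)))) ⟩
    0# + ∑ (λ l → ι (δ i l) * v (suc l)) ≈⟨ R.+-identityˡ _ ⟩
    ∑ (λ l → ι (δ i l) * v (suc l))      ≈⟨ ∑-δ i (v ∘ suc) ⟩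
    v (suc i)                            ∎

  e-∙ : ∀ {d} (α : Vector Carrier d) i → e i ∙ α ≈ α i
  e-∙ α i = R.trans (∑-cong λ l → R.*-congʳ (R.reflexive (≡.cong ι (lookup-e i l)))) (∑-δ i α)

  ⊕e-∙ : ∀ {d} (α : Vector Carrier d) x i → (x ⊕ e i) ∙ α ≈ x ∙ α + α i
  ⊕e-∙ α x i = R.trans (⊕-∙ α x (e i)) (R.+-congˡ (e-∙ α i))

  ι-sum : ∀ {n} (f : Vector ℤ n) → ι (sum f) ≈ ∑ (ι ∘ f)
  ι-sum {zero}  f = R.refl
  ι-sum {suc n} f = R.trans (ι-+ (f zero) _) (R.+-congˡ (ι-sum (f ∘ suc)))

  -- Exchanging the two sums moves M to the other side of the scalar product, where it acts as its
  -- transpose.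
  ·-∙ : ∀ {d} (M : Matrix d) x (α : Vector Carrier d) →
        (M · x) ∙ α ≈ x ∙ (λ c → ∑ λ r → ι (M r c) * α r)
  ·-∙ M x α = begin
    (M · x) ∙ α
      ≈⟨ ∑-cong (λ r → R.*-congʳ (R.trans (R.reflexive (≡.cong ι (Vec.lookup∘tabulate _ r)))
                                          (ι-sum λ c → M r c ℤ.* Vec.lookup x c))) ⟩
    ∑ (λ r → ∑ (λ c → ι (M r c ℤ.* Vec.lookup x c)) * α r)
      ≈⟨ ∑-cong (λ r → *-distribʳ-sum (α r) (λ c → ι (M r c ℤ.* Vec.lookup x c))) ⟩
    ∑ (λ r → ∑ λ c → ι (M r c ℤ.* Vec.lookup x c) * α r)
      ≈⟨ ∑-comm (λ r c → ι (M r c ℤ.* Vec.lookup x c) * α r) ⟩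
    ∑ (λ c → ∑ λ r → ι (M r c ℤ.* Vec.lookup x c) * α r)
      ≈⟨ ∑-cong (λ c → ∑-cong λ r → R.trans (R.*-congʳ (ι-* (M r c) (Vec.lookup x c)))
           (solve 3 (λ m x a → (m :* x) :* a := x :* (m :* a)) R.refl
                  (ι (M r c)) (ι (Vec.lookup x c)) (α r))) ⟩
    ∑ (λ c → ∑ λ r → ι (Vec.lookup x c) * (ι (M r c) * α r))
      ≈⟨ ∑-cong (λ c → *-distribˡ-sum (ι (Vec.lookup x c)) (λ r → ι (M r c) * α r)) ⟨
    x ∙ (λ c → ∑ λ r → ι (M r c) * α r) ∎

  module _ {d : ℕ} (α : Vector Carrier d) where

    weight : Letter d → Carrier
    weight (j , s) = ι (s ℤ.◃ 1) * α j

    -- The scalar product of α with `abelianize w`, computed letter by letter, so that inductions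
    -- can follow the word.
    length-∙ : List (Letter d) → Carrier
    length-∙ []      = 0#
    length-∙ (l ∷ w) = weight l + length-∙ w

    abelianize-∙ : ∀ w → abelianize w ∙ α ≈ length-∙ w
    abelianize-∙ [] = R.trans
      (∑-cong λ i → R.trans (R.*-congʳ (R.reflexive (≡.cong ι (Vec.lookup∘tabulate _ i)))) (R.zeroˡ (α i)))
      (∑-zero d)
    abelianize-∙ ((j , s) ∷ w) = begin
      abelianize ((j , s) ∷ w) ∙ α         ≈⟨ ∙-congʳ α (abelianize ((j , s) ∷ w)) ((s ℤ.◃ 1) ⊙ e j ⊕ abelianize w) step ⟩
      ((s ℤ.◃ 1) ⊙ e j ⊕ abelianize w) ∙ α ≈⟨ ⊕-∙ α ((s ℤ.◃ 1) ⊙ e j) (abelianize w) ⟩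
      ((s ℤ.◃ 1) ⊙ e j) ∙ α + abelianize w ∙ α
        ≈⟨ R.+-cong (R.trans (⊙-∙ α (s ℤ.◃ 1) (e j)) (R.*-congˡ (e-∙ α j))) (abelianize-∙ w) ⟩
      weight (j , s) + length-∙ w          ∎
      where
      scaled-δ : ∀ k (b : Bool) → (if b then k else 0ℤ) ≡ k ℤ.* (if b then 1ℤ else 0ℤ)
      scaled-δ k true  = ≡.sym (ℤ.*-identityʳ k)
      scaled-δ k false = ≡.sym (ℤ.*-zeroʳ k)

      step : ∀ i → Vec.lookup (abelianize ((j , s) ∷ w)) i ≡
                   Vec.lookup ((s ℤ.◃ 1) ⊙ e j ⊕ abelianize w) i
      step i = ≡.trans (Vec.lookup∘tabulate _ i) (≡.sym (≡.trans
        (lookup-⊕ ((s ℤ.◃ 1) ⊙ e j) (abelianize w) i)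
        (≡.cong₂ ℤ._+_
          (≡.trans (lookup-⊙ (s ℤ.◃ 1) (e j) i)
            (≡.trans (≡.cong ((s ℤ.◃ 1) ℤ.*_) (lookup-e j i)) (≡.sym (scaled-δ (s ℤ.◃ 1) _))))
          (Vec.lookup∘tabulate _ i))))

  module _ (ρ : Carrier) where

    indicator : Carrier → ℤ
    indicator s = if does (s <? ρ) then 1ℤ else 0ℤ

    indicator-cong : ∀ {s t} → s ≈ t → indicator s ≡ indicator t
    indicator-cong {s} {t} s≈t with s <? ρ | t <? ρ
    ... | yes _   | yes _   = refl
    ... | no _    | no _    = refl
    ... | yes s<ρ | no t≮ρ  = contradiction (O.<-respˡ-≈ s≈t s<ρ) t≮ρ
    ... | no s≮ρ  | yes t<ρ = contradiction (O.<-respˡ-≈ (R.sym s≈t) t<ρ) s≮ρ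

    private
      -- As s ≤ t, the half-line t < ρ lies inside s < ρ, and the difference of the indicators
      -- singles out s < ρ ≤ t. The decisions are arguments so that splitting on them reduces both
      -- sides.
      difference : ∀ {s t t′} → s ≤ t → t′ ≈ t →
        (s<ρ? : Dec (s < ρ)) (ρ≤t′? : Dec (ρ ≤ t′)) (t<ρ? : Dec (t < ρ)) →
        (if does (s<ρ? ×-dec ρ≤t′?) then 1ℤ else 0ℤ) ≡
        (if does s<ρ? then 1ℤ else 0ℤ) ℤ.- (if does t<ρ? then 1ℤ else 0ℤ)
      difference s≤t t′≈t (yes _)  (yes ρ≤t′) (yes t<ρ) = contradiction t<ρ (≤⇒≯ (≤-respʳ-≈ t′≈t ρ≤t′))
      difference s≤t t′≈t (yes _)  (yes ρ≤t′) (no _)    = refl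
      difference s≤t t′≈t (yes _)  (no _)     (yes _)   = refl
      difference s≤t t′≈t (yes _)  (no ρ≰t′)  (no t≮ρ)  = contradiction (≤-respʳ-≈ (R.sym t′≈t) (≮⇒≥ t≮ρ)) ρ≰t′
      difference s≤t t′≈t (no s≮ρ) _          (yes t<ρ) = contradiction (≤-<-trans s≤t t<ρ) s≮ρ
      difference s≤t t′≈t (no s≮ρ) _          (no _)    = refl

    module _ {d : ℕ} {α : Vector Carrier d} (0≤α : ∀ i → 0# ≤ α i) where

      plane-value : ∀ x i → Binary.fun (𝓟 ℝ α ρ) x i ≡
                    indicator (x ∙ α) ℤ.- indicator (x ∙ α + α i)
      plane-value x i = difference
        (≤-respˡ-≈ (R.+-identityʳ _) (+-monoʳ-≤ (x ∙ α) (0≤α i))) (⊕e-∙ α x i)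
        (x ∙ α <? ρ) (ρ ≤? (x ⊕ e i) ∙ α) (x ∙ α + α i <? ρ)

      -- For an inverse letter, the shift by -eⱼ and the minus sign in the dual map together give
      -- the same form as for a letter, with weight -αⱼ.
      occurrence-value : ∀ l y → occurrence (Binary.fun (𝓟 ℝ α ρ)) l y ≡
                         indicator (y ∙ α) ℤ.- indicator (y ∙ α + weight α l)
      occurrence-value (j , Sign.+) y = ≡.trans (plane-value y j)
        (≡.cong (λ k → indicator (y ∙ α) ℤ.- k)
          (indicator-cong (R.+-congˡ (R.sym (R.trans (R.*-congʳ ι-1) (R.*-identityˡ (α j)))))))
      occurrence-value (j , Sign.-) y = ≡.trans (≡.cong ℤ.-_ (plane-value (y ⊖ e j) j))
        (≡.trans (neg-minus (indicator ((y ⊖ e j) ∙ α)) _)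
          (≡.cong₂ ℤ._-_ (indicator-cong back) (indicator-cong (begin
            (y ⊖ e j) ∙ α                       ≈⟨ solve 2 (λ x a → x := (x :+ a) :+ con (ℤ.- 1ℤ) :* a) R.refl
                                                     ((y ⊖ e j) ∙ α) (α j) ⟩
            ((y ⊖ e j) ∙ α + α j) + weight α (j , Sign.-) ≈⟨ R.+-congʳ back ⟩
            y ∙ α + weight α (j , Sign.-)         ∎))))
        where
        neg-minus : ∀ k l → ℤ.- (k ℤ.- l) ≡ l ℤ.- k
        neg-minus = ℤRing.solve-∀

        back : (y ⊖ e j) ∙ α + α j ≈ y ∙ α
        back = R.trans (R.+-congˡ (R.sym (e-∙ α j))) (⊖-∙ α y (e j))

      -- Only the scalar products of the points with α matter. The start s is arbitrary, so that the
      -- induction can pass the first letter by adding its weight to s.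
      telescope : ∀ w s (y : Fin (List.length w) → Point d) →
        (∀ k → y k ∙ α ≈ s + length-∙ α (List.take (toℕ k) w)) →
        sum (λ k → occurrence (Binary.fun (𝓟 ℝ α ρ)) (List.lookup w k) (y k)) ≡
        indicator s ℤ.- indicator (s + length-∙ α w)
      telescope [] s y _ = ≡.sym (≡.trans
        (≡.cong (λ k → indicator s ℤ.- k) (indicator-cong (R.+-identityʳ s))) (ℤ.+-inverseʳ (indicator s)))
      telescope (l ∷ w) s y y≈ = ≡.trans
        (≡.cong₂ ℤ._+_
          (≡.trans (occurrence-value l (y zero))
            (≡.cong₂ ℤ._-_ (indicator-cong y₀≈s) (indicator-cong (R.+-congʳ y₀≈s))))
          (≡.trans (telescope w (s + weight α l) (y ∘ suc)
                     (λ k → R.trans (y≈ (suc k)) (R.sym (R.+-assoc s (weight α l) _))))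
            (≡.cong (λ k → indicator (s + weight α l) ℤ.- k)
                    (indicator-cong (R.+-assoc s (weight α l) (length-∙ α w))))))
        (cancel (indicator s) (indicator (s + weight α l)) _)
        where
        cancel : ∀ k l m → (k ℤ.- l) ℤ.+ (l ℤ.- m) ≡ k ℤ.- m
        cancel = ℤRing.solve-∀

        y₀≈s : y zero ∙ α ≈ s
        y₀≈s = R.trans (y≈ zero) (R.+-identityʳ s)

      -- Here β is ᵗM_σ α. By adjointness the telescoping sum starts at ⟨x∣β⟩, and the letters of
      -- σ(i) add βᵢ in total.
      E₁*-plane : ∀ (σ : Endo d) {β : Vector Carrier d} → (∀ i → 0# ≤ β i) →
                  (∀ i → abelianize (word (σ i)) ∙ α ≈ β i) → ∀ x i →
                  E₁* σ (Binary.fun (𝓟 ℝ α ρ)) x i ≡ indicator (x ∙ β) ℤ.- indicator (x ∙ β + β i)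
      E₁*-plane σ {β} 0≤β σᵀα≈β x i = ≡.trans (E₁*-occurrences σ _ x i) (≡.trans
        (telescope (word (σ i)) (x ∙ β) (λ k → incidence σ · x ⊕ abelianize (List.take (toℕ k) (word (σ i))))
          (λ k → R.trans (⊕-∙ α (incidence σ · x) (abelianize (List.take (toℕ k) (word (σ i)))))
            (R.+-cong (R.trans (·-∙ (incidence σ) x α) (∙-congˡ σᵀα≈β x))
                      (abelianize-∙ α (List.take (toℕ k) (word (σ i)))))))
        (≡.cong (λ k → indicator (x ∙ β) ℤ.- k)
          (indicator-cong (R.+-congˡ (R.trans (R.sym (abelianize-∙ α (word (σ i)))) (σᵀα≈β i))))))

-- Arithmetic progressions reaching a threshold, and average counts.

module Crossings (em : ExcludedMiddle 0ℓ) (ℝ : Reals) where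

  open Arithmetic ℝ
  open Reals ℝ
  open import Relation.Binary.Reasoning.Setoid R.setoid

  module _ {u : Carrier} (0<u : 0# < u) where

    /-*-cancel : ∀ x → (x * u ⁻¹) * u ≈ x
    /-*-cancel x = begin
      (x * u ⁻¹) * u ≈⟨ solve 3 (λ x u v → (x :* v) :* u := x :* (u :* v)) R.refl x u (u ⁻¹) ⟩
      x * (u * u ⁻¹) ≈⟨ R.*-congˡ (⁻¹-inverseʳ u (λ u≈0 → O.irrefl (R.sym u≈0) 0<u)) ⟩
      x * 1#         ≈⟨ R.*-identityʳ x ⟩
      x              ∎

    archimedean-multiple : ∀ x → ∃[ n ] x < ι (+ n) * u
    archimedean-multiple x with archimedean em ℝ (x * u ⁻¹)
    ... | n , x/u<n = n , O.<-respˡ-≈ (/-*-cancel x) (*-monoʳ-< 0<u x/u<n)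

    -- Both a and the integer part k lie within the unit below v / u, so each is less than the other
    -- plus 1. The comparison is made after multiplication by u.
    ⌊/⌋-unique : ∀ {v} a → ι a * u ≤ v → v < ι (a ℤ.+ 1ℤ) * u → ⌊_⌋ em ℝ (v * u ⁻¹) ≡ a
    ⌊/⌋-unique {v} a au≤v v<au+u with integerPart em ℝ (v * u ⁻¹)
    ... | k , k≤v/u , v/u<k+1 = ℤ.≤-antisym
      (≤-from-< (≤-<-trans (≤-respʳ-≈ (/-*-cancel v) (*-monoʳ-≤ (inj₁ 0<u) k≤v/u)) v<au+u))
      (≤-from-< (≤-<-trans au≤v (O.<-respˡ-≈ (/-*-cancel v) (*-monoʳ-< 0<u v/u<k+1))))
      where
      ≤-from-< : ∀ {k l} → ι k * u < ι (l ℤ.+ 1ℤ) * u → k ℤ.≤ l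
      ≤-from-< {k} {l} lt = ≡.subst (k ℤ.≤_) (ℤ.pred-suc l) (ℤ.i<j⇒i≤pred[j]
        (≡.subst (k ℤ.<_) (ℤ.+-comm l 1ℤ) (ι-cancel-< (*-cancelʳ-< 0<u lt))))

  module _ (ρ u : Carrier) where

    -- For u > 0 this says that K is the least k with ρ ≤ c + k u; the two-sided form gives the
    -- comparisons on either side directly.
    Crossing : Carrier → ℤ → Set
    Crossing c K = (∀ k → k ℤ.< K → c + ι k * u < ρ) × (∀ k → K ℤ.≤ k → ρ ≤ c + ι k * u)

    Crossing-resp-≈ : ∀ {c c′ K} → c ≈ c′ → Crossing c K → Crossing c′ K
    Crossing-resp-≈ c≈c′ (before , after) =
      (λ k k<K → O.<-respˡ-≈ (R.+-congʳ c≈c′) (before k k<K)) ,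
      (λ k K≤k → ≤-respʳ-≈ (R.+-congʳ c≈c′) (after k K≤k))

    -- The last point before the threshold, at index K - 1, with `ι` already distributed over the
    -- difference as the ring solver expects.
    Crossing-pred : ∀ {c K} → Crossing c K → c + (ι K + ι (ℤ.- 1ℤ)) * u < ρ
    Crossing-pred {c} {K} (before , _) = O.<-respˡ-≈ (R.+-congˡ (R.*-congʳ (ι-+ K (ℤ.- 1ℤ))))
      (before (K ℤ.- 1ℤ) (ℤ.i≤pred[j]⇒i<j (ℤ.≤-reflexive (ℤ.+-comm K (ℤ.- 1ℤ)))))

  module _ {u : Carrier} (ρ : Carrier) (0<u : 0# < u) where

    abstract
      crossing : ∀ c → ∃ (Crossing ρ u c)
      crossing c with integerPart em ℝ ((c + - ρ) * u ⁻¹)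
      -- The least k is the ceiling of (ρ - c) / u, which is minus the integer part of (c - ρ) / u.
      ... | f , f≤ , <f+1 = ℤ.- f ,
        (λ k k<-f → shift-< {c = (c + - ρ) * u ⁻¹ * u}
          (*-monoʳ-< 0<u (<-≤-trans <f+1 (ι-mono-≤ (f+1≤ k k<-f))))
          (difference k)) ,
        (λ k -f≤k → shift-≤ (*-monoʳ-≤ (inj₁ 0<u) (≤-trans (ι-mono-≤ (≤f k -f≤k)) f≤))
          (R.sym (difference k)))
        where
        f+1≤ : ∀ k → k ℤ.< ℤ.- f → f ℤ.+ 1ℤ ℤ.≤ ℤ.- k
        f+1≤ k k<-f = ≡.subst (ℤ._≤ ℤ.- k) (ℤ.+-comm 1ℤ f)
          (ℤ.i<j⇒suc[i]≤j (≡.subst (ℤ._< ℤ.- k) (ℤ.neg-involutive f) (ℤ.neg-mono-< k<-f)))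

        ≤f : ∀ k → ℤ.- f ℤ.≤ k → ℤ.- k ℤ.≤ f
        ≤f k -f≤k = ≡.subst (ℤ.- k ℤ.≤_) (ℤ.neg-involutive f) (ℤ.neg-mono-≤ -f≤k)

        difference : ∀ k → (c + ι k * u) + ι (ℤ.- k) * u ≈ ρ + (c + - ρ) * u ⁻¹ * u
        difference k = begin
          (c + ι k * u) + ι (ℤ.- k) * u  ≈⟨ R.+-congˡ (R.*-congʳ (ι-neg k)) ⟩
          (c + ι k * u) + - ι k * u
            ≈⟨ solve 4 (λ c k u r → (c :+ k :* u) :+ (:- k) :* u := r :+ (c :- r)) R.refl c (ι k) u ρ ⟩
          ρ + (c + - ρ)                  ≈⟨ R.+-congˡ (/-*-cancel 0<u (c + - ρ)) ⟨
          ρ + (c + - ρ) * u ⁻¹ * u       ∎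

    module _ {c v K K′} (at-c : Crossing ρ u c K) (at-c+v : Crossing ρ u (c + v) K′) where

      -- From c + v + (K′ - 1) u < ρ ≤ c + K u.
      width-< : v < ι (K ℤ.- K′ ℤ.+ 1ℤ) * u
      width-< = shift-< (<-≤-trans (Crossing-pred ρ u at-c+v) (proj₂ at-c K ℤ.≤-refl)) (begin
        v + (c + ι K * u)
          ≈⟨ solve 5 (λ v c k l u → v :+ (c :+ k :* u) :=
               ((k :- l) :+ con 1ℤ) :* u :+ ((c :+ v) :+ (l :+ con (ℤ.- 1ℤ)) :* u)) R.refl v c (ι K) (ι K′) u ⟩
        (ι K + - ι K′ + ι 1ℤ) * u + ((c + v) + (ι K′ + ι (ℤ.- 1ℤ)) * u)
          ≈⟨ R.+-congʳ (R.*-congʳ (R.trans (ι-+ (K ℤ.- K′) 1ℤ)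
               (R.+-congʳ (R.trans (ι-+ K (ℤ.- K′)) (R.+-congˡ (ι-neg K′)))))) ⟨
        ι (K ℤ.- K′ ℤ.+ 1ℤ) * u + ((c + v) + (ι K′ + ι (ℤ.- 1ℤ)) * u) ∎)

      -- Otherwise c + (K′ + 1) u < ρ ≤ c + v + K′ u, which contradicts v ≤ u.
      narrow⇒≤1 : v ≤ u → K ℤ.≤ K′ ℤ.+ 1ℤ
      narrow⇒≤1 v≤u = ℤ.≮⇒≥ λ K′+1<K → ≤⇒≯ (≤-trans (proj₂ at-c+v K′ ℤ.≤-refl) (shift-≤ v≤u (begin
        ((c + v) + ι K′ * u) + u
          ≈⟨ solve 4 (λ c v k u → ((c :+ v) :+ k :* u) :+ u := (c :+ (k :+ con 1ℤ) :* u) :+ v) R.refl c v (ι K′) u ⟩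
        (c + (ι K′ + ι 1ℤ) * u) + v
          ≈⟨ R.+-congʳ (R.+-congˡ (R.*-congʳ (ι-+ K′ 1ℤ))) ⟨
        (c + ι (K′ ℤ.+ 1ℤ) * u) + v ∎))) (proj₁ at-c (K′ ℤ.+ 1ℤ) K′+1<K)

      -- Otherwise ρ ≤ c + K′ u ≤ c + v + (K′ - 1) u < ρ.
      wide⇒0< : u ≤ v → K′ ℤ.< K
      wide⇒0< u≤v = ℤ.≰⇒> λ K≤K′ → ≤⇒≯ (≤-trans (proj₂ at-c K′ K≤K′) (shift-≤ u≤v
        (solve 4 (λ c v k u → (c :+ k :* u) :+ v := ((c :+ v) :+ (k :+ con (ℤ.- 1ℤ)) :* u) :+ u) R.refl c v (ι K′) u)))
        (Crossing-pred ρ u at-c+v)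

    -- The half-open intervals of length v starting at the multiples of v tile the line, so
    -- that the number of multiples of u in them is v / u on average.
    module _ (v : Carrier) (n : ℤ) where

      private
        K : ℕ → ℤ
        K m = proj₁ (crossing (ι (+ m) * v))

        -- The end of one interval is the beginning of the next, so the single sequence `K` provides
        -- both bounds and their differences telescope.
        next : ∀ m → Crossing ρ u (ι (+ m) * v + v) (K (suc m))
        next m = Crossing-resp-≈ ρ u
          (R.trans (R.distribʳ v 1# (ι (+ m))) (R.trans (R.+-congʳ (R.*-identityˡ v)) (R.+-comm v _)))
          (proj₂ (crossing (ι (+ suc m) * v)))

        step : ∀ k m n → k ℤ.+ n ℤ.+ m ℤ.* n ≡ k ℤ.+ (1ℤ ℤ.+ m) ℤ.* n
        step = ℤRing.solve-∀

        ι-progress : ∀ N k → ι (k ℤ.+ + N ℤ.* n) ≈ ι k + ι (+ N) * ι n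
        ι-progress N k = R.trans (ι-+ k (+ N ℤ.* n)) (R.+-congˡ (ι-* (+ N) n))

      -- Summing the bound over N intervals gives K 0 ≤ K N + N n, hence N (v - n u) < u for every
      -- N. By the Archimedean property v - n u cannot be positive.
      average-≤ : (∀ m k k′ → Crossing ρ u (ι (+ m) * v) k → Crossing ρ u (ι (+ m) * v + v) k′ →
                   k ℤ.≤ k′ ℤ.+ n) → v ≤ ι n * u
      average-≤ bound = ≮⇒≥ λ nu<v → absurd (archimedean-multiple
        (shift-< {0#} {v + - (ι n * u)} nu<v (solve 2 (λ v x → con 0ℤ :+ v := (v :- x) :+ x) R.refl v (ι n * u))) u)
        where
        total-≤ : ∀ N → K 0 ℤ.≤ K N ℤ.+ + N ℤ.* n
        total-≤ zero = ℤ.≤-reflexive (≡.sym (≡.trans (≡.cong (ℤ._+_ (K 0)) (ℤ.*-zeroˡ n)) (ℤ.+-identityʳ (K 0))))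
        total-≤ (suc N) = ℤ.≤-trans (total-≤ N) (ℤ.≤-trans
          (ℤ.+-monoˡ-≤ (+ N ℤ.* n) (bound N (K N) (K (suc N)) (proj₂ (crossing (ι (+ N) * v))) (next N)))
          (ℤ.≤-reflexive (step (K (suc N)) (+ N) n)))

        absurd : ¬ (∃[ N ] u < ι (+ N) * (v + - (ι n * u)))
        -- Adding the crossing inequalities, the choice of N and the total bound yields a strict
        -- inequality between two equal polynomials.
        absurd (N , u<) = O.irrefl
          (solve 6 (λ u v n m k l → (m :* v :+ (k :+ con (ℤ.- 1ℤ)) :* u) :+ (u :+ l :* u) :=
             (con 0ℤ :* v :+ l :* u) :+ (m :* (v :- n :* u) :+ (k :+ m :* n) :* u))
             R.refl u v (ι n) (ι (+ N)) (ι (K N)) (ι (K 0)))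
          (+-mono-<-≤
            (<-≤-trans (Crossing-pred ρ u (proj₂ (crossing (ι (+ N) * v))))
                       (proj₂ (proj₂ (crossing (ι (+ 0) * v))) (K 0) ℤ.≤-refl))
            (+-mono-≤ (inj₁ u<) (*-monoʳ-≤ (inj₁ 0<u) (≤-respʳ-≈ (ι-progress N (K N)) (ι-mono-≤ (total-≤ N))))))

      -- The same summation with the crossings at 0 and at N v exchanged: N (n u - v) < u for every
      -- N.
      average-≥ : (∀ m k k′ → Crossing ρ u (ι (+ m) * v) k → Crossing ρ u (ι (+ m) * v + v) k′ →
                   k′ ℤ.+ n ℤ.≤ k) → ι n * u ≤ v
      average-≥ bound = ≮⇒≥ λ v<nu → absurd (archimedean-multiple
        (shift-< {0#} {ι n * u + - v} v<nu (solve 2 (λ v x → con 0ℤ :+ x := (x :- v) :+ v) R.refl v (ι n * u))) u)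
        where
        total-≥ : ∀ N → K N ℤ.+ + N ℤ.* n ℤ.≤ K 0
        total-≥ zero = ℤ.≤-reflexive (≡.trans (≡.cong (ℤ._+_ (K 0)) (ℤ.*-zeroˡ n)) (ℤ.+-identityʳ (K 0)))
        total-≥ (suc N) = ℤ.≤-trans (ℤ.≤-trans
          (ℤ.≤-reflexive (≡.sym (step (K (suc N)) (+ N) n)))
          (ℤ.+-monoˡ-≤ (+ N ℤ.* n) (bound N (K N) (K (suc N)) (proj₂ (crossing (ι (+ N) * v))) (next N))))
          (total-≥ N)

        absurd : ¬ (∃[ N ] u < ι (+ N) * (ι n * u + - v))
        absurd (N , u<) = O.irrefl
          (solve 6 (λ u v n m k l → (con 0ℤ :* v :+ (l :+ con (ℤ.- 1ℤ)) :* u) :+ (u :+ (k :+ m :* n) :* u) :=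
             (m :* v :+ k :* u) :+ (m :* (n :* u :- v) :+ l :* u))
             R.refl u v (ι n) (ι (+ N)) (ι (K N)) (ι (K 0)))
          (+-mono-<-≤
            (<-≤-trans (Crossing-pred ρ u (proj₂ (crossing (ι (+ 0) * v))))
                       (proj₂ (proj₂ (crossing (ι (+ N) * v))) (K N) ℤ.≤-refl))
            (+-mono-≤ (inj₁ u<) (*-monoʳ-≤ (inj₁ 0<u) (≤-respˡ-≈ (ι-progress N (K N)) (ι-mono-≤ (total-≥ N))))))

-- Segments and runs of binary stepped functions.

face-self : ∀ {d} (x : Point d) i → face x i x i ≡ 1ℤ
face-self x i = ≡.cong₂ (λ b c → if b ∧ c then 1ℤ else 0ℤ)
  (dec-true (Vec.≡-dec ℤ._≟_ x x) refl) (dec-true (i Fin.≟ i) refl)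

T⇒≡true : ∀ {b} → T b → b ≡ true
T⇒≡true {true} _ = refl

-- The index that `segment` recovers from the p-th coordinates is k itself, and the face there takes
-- the value 1.
segment-at : ∀ {d} (x : Point d) p q I k →
             segment x p q I (x ⊕ k ⊙ e p) q ≡ (if I k then 1ℤ else 0ℤ)
segment-at x p q I k = at coordinate
  where
  coordinate : Vec.lookup (x ⊕ k ⊙ e p) p ℤ.- Vec.lookup x p ≡ k
  coordinate = ≡.trans (≡.cong (ℤ._- Vec.lookup x p) (≡.trans (lookup-⊕ x (k ⊙ e p) p)
    (≡.cong (ℤ._+_ (Vec.lookup x p)) (≡.trans (lookup-⊙ k (e p) p)
      (≡.cong (k ℤ.*_) (≡.trans (lookup-e p p) (δ-refl p)))))))
    (cancel (Vec.lookup x p) k)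
    where
    cancel : ∀ m k → (m ℤ.+ k ℤ.* 1ℤ) ℤ.- m ≡ k
    cancel = ℤRing.solve-∀

  at : ∀ {l} → l ≡ k → (if I l then face (x ⊕ l ⊙ e p) q (x ⊕ k ⊙ e p) q else 0ℤ) ≡ (if I k then 1ℤ else 0ℤ)
  at refl = ≡.cong (λ v → if I k then v else 0ℤ) (face-self (x ⊕ k ⊙ e p) q)

module BinaryRuns {d} (𝓑 : Binary d) (p q : Fin d) where

  open Binary 𝓑

  Level : Point d → ℤ → Set
  Level x k = fun (x ⊕ k ⊙ e p) q ≡ 1ℤ

  level : Point d → ℤ → Bool
  level x k = isYes (fun (x ⊕ k ⊙ e p) q ℤ.≟ 1ℤ)

  0≤fun : ∀ x i → 0ℤ ℤ.≤ fun x i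
  0≤fun x i with binary x i
  ... | inj₁ ≡0 = ℤ.≤-reflexive (≡.sym ≡0)
  ... | inj₂ ≡1 = ≡.subst (0ℤ ℤ.≤_) (≡.sym ≡1) (ℤ.+≤+ ℕ.z≤n)

  segment-below⇒Level : ∀ x I → segment x p q I ≼ fun → ∀ k → T (I k) → Level x k
  segment-below⇒Level x I below k k∈I with binary (x ⊕ k ⊙ e p) q
  ... | inj₂ ≡1 = ≡1
  ... | inj₁ ≡0 with ≡.subst₂ ℤ._≤_
      (≡.trans (segment-at x p q I k) (≡.cong (if_then 1ℤ else 0ℤ) (T⇒≡true k∈I))) ≡0
      (below (x ⊕ k ⊙ e p) q)
  ...   | ℤ.+≤+ ()

  -- Where the segment vanishes, non-negativity of `fun` suffices; elsewhere the point is x + k eₚ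
  -- and the assumption on I applies.
  Level⇒segment-below : ∀ x I → (∀ k → T (I k) → Level x k) → segment x p q I ≼ fun
  Level⇒segment-below x I on-level y l =
    bound (I k) (Vec.≡-dec ℤ._≟_ y (x ⊕ k ⊙ e p)) (l Fin.≟ q) (on-level k)
    where
    k : ℤ
    k = Vec.lookup y p ℤ.- Vec.lookup x p

    bound : ∀ (b : Bool) {z} (y≟z : Dec (y ≡ z)) (l≟q : Dec (l ≡ q)) → (T b → fun z q ≡ 1ℤ) →
            (if b then (if does y≟z ∧ does l≟q then 1ℤ else 0ℤ) else 0ℤ) ℤ.≤ fun y l
    bound false _          _          _  = 0≤fun y l
    bound true  (no _)     _          _  = 0≤fun y l
    bound true  (yes _)    (no _)     _  = 0≤fun y l
    bound true  (yes refl) (yes refl) ≡1 = ℤ.≤-reflexive (≡.sym (≡1 _))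

  nonZero⇒nonEmpty : (R : Run 𝓑 p q) → ∃[ k ] T (Run.interval R k)
  nonZero⇒nonEmpty R with Run.nonZero R
  ... | y , l , ≢0 = Vec.lookup y p ℤ.- Vec.lookup (Run.base R) p , inhabited _ ≢0
    where
    inhabited : ∀ b {n} → (if b then n else 0ℤ) ≢ 0ℤ → T b
    inhabited true  _  = _
    inhabited false ≢0 = ≢0 refl

  module _ (convex : ∀ x → Convex (level x)) where

    interval⇒Level : ∀ (R : Run 𝓑 p q) k → T (Run.interval R k) → Level (Run.base R) k
    interval⇒Level R = segment-below⇒Level (Run.base R) (Run.interval R) (Run.below R)

    -- When level sets are convex, maximality can be applied to the whole level set: a run then
    -- contains all faces of its type on its line.
    Level⇒interval : ∀ (R : Run 𝓑 p q) k → Level (Run.base R) k → T (Run.interval R k)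
    Level⇒interval R k on-level = Run.maximal R (level (Run.base R)) (convex (Run.base R))
      (Level⇒segment-below (Run.base R) (level (Run.base R)) (λ _ → toWitness))
      (λ l l∈I → fromWitness (interval⇒Level R l l∈I)) k (fromWitness on-level)

    -- The interval is the entire level set, and k witnesses that it is not empty.
    runThrough : ∀ x k → Level x k → Run 𝓑 p q
    runThrough x k on-level = record
      { base     = x
      ; interval = level x
      ; convex   = convex x
      ; nonZero  = x ⊕ k ⊙ e p , q , λ ≡0 → 1≢0 (≡.trans (≡.sym
          (≡.trans (segment-at x p q (level x) k)
                   (≡.cong (if_then 1ℤ else 0ℤ) (T⇒≡true (fromWitness on-level))))) ≡0)
      ; below    = Level⇒segment-below x (level x) (λ _ → toWitness)
      ; maximal  = λ J _ below _ k k∈J → fromWitness (segment-below⇒Level x J below k k∈J)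
      }
      where
      1≢0 : 1ℤ ≢ 0ℤ
      1≢0 ()

-- Lengths of integer intervals.

[i+j]-i≡j : ∀ i j → (i ℤ.+ j) ℤ.- i ≡ j
[i+j]-i≡j = ℤRing.solve-∀

i+[j-i]≡j : ∀ i j → i ℤ.+ (j ℤ.- i) ≡ j
i+[j-i]≡j = ℤRing.solve-∀

-- The bijection is m ↦ lo + m. Proofs of `T (I k)` are unique, so that pairs are compared by their
-- integers.
interval-length : ∀ (I : ℤ → Bool) lo n → (∀ k → T (I k) → lo ℤ.≤ k × k ℤ.< lo ℤ.+ + n) →
                  (∀ k → lo ℤ.≤ k → k ℤ.< lo ℤ.+ + n → T (I k)) → Fin n ↔ Σ ℤ (T ∘ I)
interval-length I lo n bounds fill = mk↔ₛ′ to from to-from from-to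
  where
  Σ-≡ : ∀ {k l} {t : T (I k)} {t′ : T (I l)} → k ≡ l → _≡_ {A = Σ ℤ (T ∘ I)} (k , t) (l , t′)
  Σ-≡ {k} refl = ≡.cong (k ,_) (T-irrelevant _ _)

  distance : ∀ {k} → lo ℤ.≤ k → + ℤ.∣ k ℤ.- lo ∣ ≡ k ℤ.- lo
  distance lo≤k = ℤ.0≤i⇒+∣i∣≡i (ℤ.i≤j⇒0≤j-i lo≤k)

  distance< : ∀ {k} → lo ℤ.≤ k → k ℤ.< lo ℤ.+ + n → ℤ.∣ k ℤ.- lo ∣ ℕ.< n
  distance< {k} lo≤k k<lo+n = ℤ.drop‿+<+ (≡.subst₂ ℤ._<_ (≡.sym (distance lo≤k)) ([i+j]-i≡j lo (+ n))
    (ℤ.+-monoˡ-< (ℤ.- lo) k<lo+n))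

  to : Fin n → Σ ℤ (T ∘ I)
  to m = lo ℤ.+ + toℕ m , fill _ (ℤ.i≤i+j lo (+ toℕ m)) (ℤ.+-monoʳ-< lo (ℤ.+<+ (Fin.toℕ<n m)))

  from : Σ ℤ (T ∘ I) → Fin n
  from (k , k∈I) = Fin.fromℕ< (distance< (proj₁ (bounds k k∈I)) (proj₂ (bounds k k∈I)))

  to-from : ∀ x → to (from x) ≡ x
  to-from (k , k∈I) = Σ-≡ (≡.trans
    (≡.cong (λ m → lo ℤ.+ + m) (Fin.toℕ-fromℕ< (distance< (proj₁ (bounds k k∈I)) (proj₂ (bounds k k∈I)))))
    (≡.trans (≡.cong (ℤ._+_ lo) (distance (proj₁ (bounds k k∈I)))) (i+[j-i]≡j lo k)))

  from-to : ∀ m → from (to m) ≡ m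
  from-to m = Fin.toℕ-injective (≡.trans (Fin.toℕ-fromℕ< _) (≡.cong ℤ.∣_∣ ([i+j]-i≡j lo (+ toℕ m))))

HasLength-unique : ∀ {d} {𝓑 : Binary d} {p q} (R : Run 𝓑 p q) {m n} →
                   HasLength R m → HasLength R n → m ≡ n
HasLength-unique R m-long n-long = ↔⇒≡ (↔-trans m-long (↔-sym n-long))

indicated : ∀ {P : Set} (P? : Dec P) → (if does P? then 1ℤ else 0ℤ) ≡ 1ℤ → P
indicated (yes p) _ = p

indicate : ∀ {P : Set} (P? : Dec P) → P → (if does P? then 1ℤ else 0ℤ) ≡ 1ℤ
indicate (yes _)  _ = refl
indicate (no ¬p)  p = contradiction p ¬p

gap : ∀ {k l} → k ℤ.≤ l → ∃[ n ] l ≡ k ℤ.+ + n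
gap {k} {l} k≤l = ℤ.∣ l ℤ.- k ∣ , ≡.sym (≡.trans
  (≡.cong (ℤ._+_ k) (ℤ.0≤i⇒+∣i∣≡i (ℤ.i≤j⇒0≤j-i k≤l))) (i+[j-i]≡j k l))

-- Runs of a stepped plane and admissible pairs.

module PlaneRuns (em : ExcludedMiddle 0ℓ) (ℝ : Reals) {d : ℕ} {α : Vector (Reals.Carrier ℝ) d}
                 (0≤α : ∀ i → Reals._≤_ ℝ (Reals.0# ℝ) (α i)) (ρ : Reals.Carrier ℝ) where

  open Arithmetic ℝ
  open Planes ℝ
  open Crossings em ℝ
  open Reals ℝ

  private
    P : Binary d
    P = 𝓟 ℝ α ρ

  module _ (p q : Fin d) where

    open BinaryRuns P p q

    shifted : ∀ x k → (x ⊕ k ⊙ e p) ∙ α ≈ x ∙ α + ι k * α p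
    shifted x k = R.trans (⊕-∙ α x (k ⊙ e p))
      (R.+-congˡ (R.trans (⊙-∙ α k (e p)) (R.*-congˡ (e-∙ α p))))

    shifted-e : ∀ x k → (x ⊕ k ⊙ e p ⊕ e q) ∙ α ≈ (x ∙ α + α q) + ι k * α p
    shifted-e x k = R.trans (⊕e-∙ α (x ⊕ k ⊙ e p) q) (R.trans (R.+-congʳ (shifted x k))
      (solve 3 (λ a b c → (a :+ b) :+ c := (a :+ c) :+ b) R.refl (x ∙ α) (ι k * α p) (α q)))

    Level⇒bounds : ∀ x k → Level x k → x ∙ α + ι k * α p < ρ × ρ ≤ (x ∙ α + α q) + ι k * α p
    Level⇒bounds x k on-level
      with indicated (((x ⊕ k ⊙ e p) ∙ α <? ρ) ×-dec (ρ ≤? (x ⊕ k ⊙ e p ⊕ e q) ∙ α)) on-level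
    ... | lower , upper = O.<-respˡ-≈ (shifted x k) lower , ≤-respʳ-≈ (shifted-e x k) upper

    bounds⇒Level : ∀ x k → x ∙ α + ι k * α p < ρ → ρ ≤ (x ∙ α + α q) + ι k * α p → Level x k
    bounds⇒Level x k lower upper =
      indicate (((x ⊕ k ⊙ e p) ∙ α <? ρ) ×-dec (ρ ≤? (x ⊕ k ⊙ e p ⊕ e q) ∙ α))
        (O.<-respˡ-≈ (R.sym (shifted x k)) lower , ≤-respʳ-≈ (R.sym (shifted-e x k)) upper)

    shift-mono : ∀ c {k l} → k ℤ.≤ l → c + ι k * α p ≤ c + ι l * α p
    shift-mono c k≤l = +-monoʳ-≤ c (*-monoʳ-≤ (0≤α p) (ι-mono-≤ k≤l))

    -- As αₚ ≥ 0, the upper bound by ρ passes to smaller indices and the lower bound to larger ones.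
    level-convex : ∀ x → Convex (level x)
    level-convex x {k} {l} {m} k≤l l≤m k∈ m∈ = fromWitness (bounds⇒Level x l
      (≤-<-trans (shift-mono (x ∙ α) l≤m) (proj₁ (Level⇒bounds x m (toWitness m∈))))
      (≤-trans (proj₂ (Level⇒bounds x k (toWitness k∈))) (shift-mono (x ∙ α + α q) k≤l)))

    -- If αₚ = 0, the bounds do not depend on k, so the run contains every integer and ℕ would
    -- inject into `Fin n`.
    finite-run⇒0< : ∀ {n} (R : Run P p q) → HasLength R n → 0# < α p
    finite-run⇒0< {n} R n-long = ≤∧≉⇒< (0≤α p) λ 0≈αp →
      Fin.ℕ→Fin-notInjective (λ m → Inverse.from n-long (+ m , everywhere 0≈αp (+ m)))
        λ {m} {m′} eq → ℤ.+-injective (≡.cong proj₁ (≡.trans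
          (≡.sym (Inverse.strictlyInverseˡ n-long _))
          (≡.trans (≡.cong (Inverse.to n-long) eq) (Inverse.strictlyInverseˡ n-long _))))
      where
      everywhere : 0# ≈ α p → ∀ k → T (Run.interval R k)
      everywhere 0≈αp k with nonZero⇒nonEmpty R
      ... | l , l∈ with Level⇒bounds (Run.base R) l (interval⇒Level level-convex R l l∈)
      ...   | lower , upper = Level⇒interval level-convex R k (bounds⇒Level (Run.base R) k
                (O.<-respˡ-≈ (same _) lower) (≤-respʳ-≈ (same _) upper))
        where
        vanish : ∀ m → ι m * α p ≈ 0#
        vanish m = R.trans (R.*-congˡ (R.sym 0≈αp)) (R.zeroʳ (ι m))

        same : ∀ c → c + ι l * α p ≈ c + ι k * α p
        same c = R.+-congˡ (R.trans (vanish l) (R.sym (vanish k)))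

    -- Any face of the run gives s < ρ ≤ s + α q for some s.
    run⇒0< : Run P p q → 0# < α q
    run⇒0< R with nonZero⇒nonEmpty R
    ... | l , l∈ with Level⇒bounds (Run.base R) l (interval⇒Level level-convex R l l∈)
    ...   | lower , upper = shift-< (<-≤-trans lower upper)
      (solve 3 (λ a b c → con 0ℤ :+ ((a :+ b) :+ c) := b :+ (a :+ c)) R.refl
             (Run.base R ∙ α) (α q) (ι l * α p))

    -- The level set on the line through x is K′ ≤ k < K: `start` is its first index and `end` the
    -- first index past it. It is empty when K ≤ K′.
    record Ends (x : Point d) (K K′ : ℤ) : Set where
      constructor _&_
      field
        end   : Crossing ρ (α p) (x ∙ α) K
        start : Crossing ρ (α p) (x ∙ α + α q) K′

    Level⇒Ends : ∀ {x K K′} → Ends x K K′ → ∀ k → Level x k → K′ ℤ.≤ k × k ℤ.< K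
    Level⇒Ends {x} (at-x & at-x+e) k on-level with Level⇒bounds x k on-level
    ... | lower , upper =
      ℤ.≮⇒≥ (λ k<K′ → ≤⇒≯ upper (proj₁ at-x+e k k<K′)) ,
      ℤ.≰⇒> (λ K≤k → ≤⇒≯ (proj₂ at-x k K≤k) lower)

    Ends⇒Level : ∀ {x K K′} → Ends x K K′ → ∀ k → K′ ℤ.≤ k → k ℤ.< K → Level x k
    Ends⇒Level {x} (at-x & at-x+e) k K′≤k k<K =
      bounds⇒Level x k (proj₁ at-x k k<K) (proj₂ at-x+e k K′≤k)

    run-length : ∀ (R : Run P p q) {K K′ n} → Ends (Run.base R) K K′ → K ≡ K′ ℤ.+ + n → HasLength R n
    run-length R {K} {K′} {n} ends refl = interval-length (Run.interval R) K′ n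
      (λ k k∈ → Level⇒Ends ends k (interval⇒Level level-convex R k k∈))
      (λ k K′≤k k<K → Level⇒interval level-convex R k (Ends⇒Level ends k K′≤k k<K))

    run-nonEmpty : ∀ (R : Run P p q) {K K′} → Ends (Run.base R) K K′ → K′ ℤ.< K
    run-nonEmpty R ends with nonZero⇒nonEmpty R
    ... | k , k∈ with Level⇒Ends ends k (interval⇒Level level-convex R k k∈)
    ...   | K′≤k , k<K = ℤ.≤-<-trans K′≤k k<K

    run-at : ∀ {x K K′ n} → Ends x K K′ → K′ ℤ.< K → K ≡ K′ ℤ.+ + n → RunOfLength em P p q n
    run-at {x} {K} {K′} ends K′<K eq = R , run-length R ends eq
      where
      R : Run P p q
      R = runThrough level-convex x K′ (Ends⇒Level ends K′ ℤ.≤-refl K′<K)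

    module _ (0<αp : 0# < α p) where

      ends : ∀ x → ∃₂ (Ends x)
      ends x = proj₁ at-x , proj₁ at-x+e , (proj₂ at-x & proj₂ at-x+e)
        where
        at-x = crossing ρ 0<αp (x ∙ α)
        at-x+e = crossing ρ 0<αp (x ∙ α + α q)

      -- The width of the interval is at most 1 because α q ≤ α p, and at least 1 because a run is
      -- not empty.
      ≤⇒unit-runs : α q ≤ α p → ∀ (R : Run P p q) → HasLength R 1
      ≤⇒unit-runs αq≤αp R with ends (Run.base R)
      ... | K , K′ , ends@(at-x & at-x+e) = run-length R ends (ℤ.≤-antisym
        (narrow⇒≤1 ρ 0<αp at-x at-x+e αq≤αp)
        (≡.subst (ℤ._≤ K) (ℤ.+-comm 1ℤ K′) (ℤ.i<j⇒suc[i]≤j (run-nonEmpty R ends))))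

      -- Since ⟨m e_q∣α⟩ = m α q, the lines through the points m e_q realize the tiling used for the
      -- averages.
      multiple-ends : ∀ m {K K′} → Crossing ρ (α p) (ι (+ m) * α q) K →
                      Crossing ρ (α p) (ι (+ m) * α q + α q) K′ → Ends ((+ m) ⊙ e q) K K′
      multiple-ends m at-m at-m+1 =
        Crossing-resp-≈ ρ (α p) (R.sym value) at-m &
        Crossing-resp-≈ ρ (α p) (R.+-congʳ (R.sym value)) at-m+1
        where
        value : ((+ m) ⊙ e q) ∙ α ≈ ι (+ m) * α q
        value = R.trans (⊙-∙ α (+ m) (e q)) (R.*-congˡ (e-∙ α q))

      unit-runs⇒≤ : (∀ (R : Run P p q) → HasLength R 1) → α q ≤ α p
      unit-runs⇒≤ unit = ≤-respʳ-≈ (R.trans (R.*-congʳ ι-1) (R.*-identityˡ (α p)))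
        (average-≤ ρ 0<αp (α q) 1ℤ λ m K K′ at-m at-m+1 → bound m (multiple-ends m at-m at-m+1))
        where
        bound : ∀ m {K K′} → Ends ((+ m) ⊙ e q) K K′ → K ℤ.≤ K′ ℤ.+ 1ℤ
        bound m {K} {K′} ends with K ℤ.≤? K′
        -- On this line there is no run, and the bound is immediate; otherwise the width is the
        -- length of a run, hence 1.
        ... | yes K≤K′ = ℤ.≤-trans K≤K′ (ℤ.i≤i+j K′ 1ℤ)
        ... | no K≰K′ = ℤ.≤-reflexive (≡.trans (proj₂ K-K′)
          (≡.cong (λ n → K′ ℤ.+ + n) (HasLength-unique (proj₁ run) (proj₂ run) (unit (proj₁ run)))))
          where
          K′<K = ℤ.≰⇒> K≰K′
          K-K′ = gap (ℤ.<⇒≤ K′<K)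
          run = run-at ends K′<K (proj₂ K-K′)

      module _ (αp≤αq : α p ≤ α q) where

        -- As αₚ ≤ α q, no line in direction eₚ has an empty level set.
        finite-run : ∀ {x K K′} → Ends x K K′ → ∃[ n ] K ≡ K′ ℤ.+ + n × RunOfLength em P p q n
        finite-run ends@(at-x & at-x+e) =
          proj₁ K-K′ , proj₂ K-K′ , run-at ends K′<K (proj₂ K-K′)
          where
          K′<K = wide⇒0< ρ 0<αp at-x at-x+e αp≤αq
          K-K′ = gap (ℤ.<⇒≤ K′<K)

        -- Every line carries a run of length at least a, so the average does too, which is the
        -- lower bound. The upper bound comes from the width of one shortest run. The inequality is
        -- returned as well, since it makes the Brun image non-negative.
        ⌊/⌋-shortest-run : ∀ {a} → Least ℕ._<_ (RunOfLength em P p q) a →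
                           ι (+ a) * α p ≤ α q × ⌊_⌋ em ℝ (α q * α p ⁻¹) ≡ + a
        ⌊/⌋-shortest-run {a} ((R , a-long) , shortest) =
          lower , ⌊/⌋-unique 0<αp (+ a) lower upper
          where
          lower : ι (+ a) * α p ≤ α q
          lower = average-≥ ρ 0<αp (α q) (+ a) λ m K K′ at-m at-m+1 → bound (multiple-ends m at-m at-m+1)
            where
            bound : ∀ {x K K′} → Ends x K K′ → K′ ℤ.+ + a ℤ.≤ K
            bound {K′ = K′} ends = at-least (finite-run ends)
              where
              at-least : ∀ {K} → ∃[ n ] K ≡ K′ ℤ.+ + n × RunOfLength em P p q n → K′ ℤ.+ + a ℤ.≤ K
              at-least (n , refl , run) =
                ℤ.+-monoʳ-≤ K′ (ℤ.+≤+ (ℕ.≮⇒≥ λ n<a → shortest n n<a run))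

          upper : α q < ι (+ a ℤ.+ 1ℤ) * α p
          upper = below (proj₂ (proj₂ (ends (Run.base R))))
            where
            below : ∀ {K K′} → Ends (Run.base R) K K′ → α q < ι (+ a ℤ.+ 1ℤ) * α p
            below {K} {K′} ends@(at-x & at-x+e) = ≡.subst (λ k → α q < ι (k ℤ.+ 1ℤ) * α p)
              (≡.trans (≡.cong (ℤ._- K′) (≡.trans K≡K′+n
                (≡.cong (λ n → K′ ℤ.+ + n) (HasLength-unique R (run-length R ends K≡K′+n) a-long))))
                ([i+j]-i≡j K′ (+ a)))
              (width-< ρ 0<αp at-x at-x+e)
              where
              K≡K′+n = proj₁ (proj₂ (finite-run ends))

  -- The finite run of condition (2) forces αⱼ > 0; the unit lengths of condition (1) along eᵢ and
  -- eⱼ then bound the other entries by αᵢ and αⱼ.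
  admissible⇒maxPair : ∀ {i j} → Admissible P (i , j) → MaxPair ℝ α (i , j) × 0# < α j
  admissible⇒maxPair {i} {j} (i≢j , unit , n , R , n-long) = (i≢j , maxᵢ , maxⱼ) , 0<αj
    where
    0<αj : 0# < α j
    0<αj = finite-run⇒0< j i R n-long

    maxᵢ : ∀ k → α k ≤ α i
    maxᵢ k with k Fin.≟ i
    ... | yes refl = ≤-refl
    -- A run of type i also shows αᵢ > 0, as required for the averages along eᵢ.
    ... | no k≢i   = unit-runs⇒≤ i k (run⇒0< j i R) (proj₁ (unit k k≢i))

    maxⱼ : ∀ k → k ≢ i → α k ≤ α j
    maxⱼ k k≢i with k Fin.≟ j
    ... | yes refl = ≤-refl
    ... | no k≢j   = unit-runs⇒≤ j k 0<αj (proj₂ (unit k k≢i) k≢j)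

  maxPair⇒admissible : ∀ {i j} → MaxPair ℝ α (i , j) → 0# < α j → Admissible P (i , j)
  maxPair⇒admissible {i} {j} (i≢j , maxᵢ , maxⱼ) 0<αj =
    i≢j ,
    (λ k k≢i → ≤⇒unit-runs i k (<-≤-trans 0<αj (maxᵢ j)) (maxᵢ k) ,
               λ k≢j → ≤⇒unit-runs j k 0<αj (maxⱼ k k≢i)) ,
    run
    where
    run : ∃₂ λ n (R : Run P j i) → HasLength R n
    run = proj₁ finite , proj₂ (proj₂ finite)
      where
      -- The base point `e i` is an arbitrary choice: every line in direction eⱼ carries a run.
      finite = finite-run j i 0<αj (maxᵢ j) (proj₂ (proj₂ (ends j i 0<αj (e i))))

-- Neither minimum can be smaller than the other, since each satisfies the other predicate.
-- Agreement of the predicates is asked for at these two points alone.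
Least-unique : ∀ {d} {Q Q′ : Pred (Fin d × Fin d) 0ℓ} {x y} → Least _<ₗₑₓ_ Q x → Least _<ₗₑₓ_ Q′ y →
               Q′ x → Q y → x ≡ y
Least-unique {x = x} {y} (_ , x-least) (_ , y-least) q′x qy
  with ×-compare ≡.sym Fin.<-cmp Fin.<-cmp x y
... | tri< x<y _ _ = contradiction q′x (y-least x x<y)
... | tri≈ _ (refl , refl) _ = refl
... | tri> _ _ y<x = contradiction qy (x-least y y<x)

-- The Brun map and the dual map of the inverse Brun substitution.

module Brun (ℝ : Reals) where

  open Arithmetic ℝ
  open Planes ℝ
  open Reals ℝ
  open Sum R.semiring using () renaming (sum-cong-≋ to ∑-cong)
  open import Relation.Binary.Reasoning.Setoid R.setoid

  𝓟-cong : ∀ {d} {α β : Vector Carrier d} → (∀ i → 0# ≤ α i) → (∀ i → α i ≈ β i) → ∀ ρ →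
           Binary.fun (𝓟 ℝ α ρ) ≐ Binary.fun (𝓟 ℝ β ρ)
  𝓟-cong {α = α} {β} 0≤α α≈β ρ x i = ≡.trans (plane-value ρ 0≤α x i) (≡.trans
    (≡.cong₂ ℤ._-_ (indicator-cong ρ (∙-congˡ α≈β x)) (indicator-cong ρ (R.+-cong (∙-congˡ α≈β x) (α≈β i))))
    (≡.sym (plane-value ρ (λ i → ≤-respʳ-≈ (α≈β i) (0≤α i)) x i)))

  ∑-δ₂ : ∀ {d} (α : Vector Carrier d) p q i j (row : Vector ℤ d) →
         (∀ l → row l ≡ p ℤ.* δ i l ℤ.+ q ℤ.* δ j l) →
         ∑ (λ l → ι (row l) * α l) ≈ ι p * α i + ι q * α j
  ∑-δ₂ α p q i j row row≡ = begin
    ∑ (λ l → ι (row l) * α l)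
      ≈⟨ ∑-cong (λ l → R.*-congʳ (R.reflexive (≡.cong ι (≡.trans (row≡ l) (≡.sym (entry l)))))) ⟩
    (p ⊙ e i ⊕ q ⊙ e j) ∙ α          ≈⟨ ⊕-∙ α (p ⊙ e i) (q ⊙ e j) ⟩
    (p ⊙ e i) ∙ α + (q ⊙ e j) ∙ α
      ≈⟨ R.+-cong (R.trans (⊙-∙ α p (e i)) (R.*-congˡ (e-∙ α i)))
                  (R.trans (⊙-∙ α q (e j)) (R.*-congˡ (e-∙ α j))) ⟩
    ι p * α i + ι q * α j            ∎
    where
    entry : ∀ l → Vec.lookup (p ⊙ e i ⊕ q ⊙ e j) l ≡ p ℤ.* δ i l ℤ.+ q ℤ.* δ j l
    entry l = ≡.trans (lookup-⊕ (p ⊙ e i) (q ⊙ e j) l) (≡.cong₂ ℤ._+_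
      (≡.trans (lookup-⊙ p (e i) l) (≡.cong (p ℤ.*_) (lookup-e i l)))
      (≡.trans (lookup-⊙ q (e j) l) (≡.cong (q ℤ.*_) (lookup-e j l))))

  module _ {d} (α : Vector Carrier d) {i j : Fin d} (i≢j : i ≢ j) (a : ℕ) where

    -- The block is the inverse of `brunMatrix (+ a) i j` chosen in `brunMatrix-invertible`.
    brunStep : Vector Carrier d
    brunStep r = ∑ λ c → ι (block i j 0ℤ 1ℤ 1ℤ (ℤ.- + a) r c) * α c

    brunStep-i : brunStep i ≈ α j
    brunStep-i = R.trans (∑-δ₂ α 0ℤ 1ℤ i j _ (block-row-i i≢j 0ℤ 1ℤ 1ℤ (ℤ.- + a)))
      (solve 2 (λ x y → con 0ℤ :* x :+ con 1ℤ :* y := y) R.refl (α i) (α j))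

    brunStep-j : brunStep j ≈ α i + - (ι (+ a) * α j)
    brunStep-j = R.trans (∑-δ₂ α 1ℤ (ℤ.- + a) i j _ (block-row-j i≢j 0ℤ 1ℤ 1ℤ (ℤ.- + a)))
      (R.trans (R.+-congˡ (R.*-congʳ (ι-neg (+ a))))
        (solve 3 (λ x y a → con 1ℤ :* x :+ (:- a) :* y := x :- a :* y) R.refl (α i) (α j) (ι (+ a))))

    brunStep-k : ∀ {k} → k ≢ i → k ≢ j → brunStep k ≈ α k
    brunStep-k {k} k≢i k≢j = R.trans
      (∑-cong λ c → R.*-congʳ (R.reflexive (≡.cong ι (block-row i≢j 0ℤ 1ℤ 1ℤ (ℤ.- + a) k≢i k≢j c))))
      (∑-δ k α)

    letter-length : ∀ k → length-∙ α ((k , Sign.+) ∷ []) ≈ α k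
    letter-length k = solve 1 (λ x → con 1ℤ :* x :+ con 0ℤ := x) R.refl (α k)

    power-length : ∀ n → length-∙ α (List.replicate n (j , Sign.-) List.++ (i , Sign.+) ∷ []) ≈
                   α i + - (ι (+ n) * α j)
    power-length zero = R.trans (letter-length i)
      (solve 2 (λ x y → x := x :- con 0ℤ :* y) R.refl (α i) (α j))
    power-length (suc n) = begin
      ι (ℤ.- 1ℤ) * α j + _                           ≈⟨ R.+-congˡ (power-length n) ⟩
      ι (ℤ.- 1ℤ) * α j + (α i + - (ι (+ n) * α j))
        ≈⟨ solve 3 (λ x y n → con (ℤ.- 1ℤ) :* y :+ (x :- n :* y) := x :- (con 1ℤ :+ n) :* y)
                   R.refl (α i) (α j) (ι (+ n)) ⟩
      α i + - ((ι 1ℤ + ι (+ n)) * α j)               ≈⟨ R.+-congˡ (R.-‿cong (R.*-congʳ (R.+-congʳ ι-1))) ⟩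
      α i + - (ι (+ suc n) * α j)                    ∎

    -- The vector γ stands for the Brun image. Keeping it a variable keeps the case distinctions
    -- inside `block` out of the split on k.
    β⁻¹-length : ∀ {γ : Vector Carrier d} → γ i ≈ α j → γ j ≈ α i + - (ι (+ a) * α j) →
                 (∀ {k} → k ≢ i → k ≢ j → γ k ≈ α k) →
                 ∀ k → length-∙ α (word (β⁻¹ a i j i≢j k)) ≈ γ k
    β⁻¹-length γi γj γk k with k Fin.≟ i | k Fin.≟ j
    ... | yes refl | _        = R.trans (letter-length j) (R.sym γi)
    ... | no _     | yes refl = R.trans (power-length a) (R.sym γj)
    ... | no k≢i   | no k≢j   = R.trans (letter-length k) (R.sym (γk k≢i k≢j))

    brunStep-nonNegative : (∀ k → 0# ≤ α k) → ι (+ a) * α j ≤ α i → ∀ k → 0# ≤ brunStep k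
    brunStep-nonNegative 0≤α aαj≤αi = cases (λ k → 0# ≤ brunStep k)
      (≤-respʳ-≈ (R.sym brunStep-i) (0≤α j))
      (≤-respʳ-≈ (R.sym brunStep-j) (shift-≤ aαj≤αi
        (solve 2 (λ x y → con 0ℤ :+ x := (x :- y) :+ y) R.refl (α i) (ι (+ a) * α j))))
      (λ k≢i k≢j → ≤-respʳ-≈ (R.sym (brunStep-k k≢i k≢j)) (0≤α _))
      where
      cases : ∀ (Q : Fin d → Set) → Q i → Q j → (∀ {k} → k ≢ i → k ≢ j → Q k) → ∀ k → Q k
      cases Q qi qj qk k with k Fin.≟ i | k Fin.≟ j
      ... | yes refl | _        = qi
      ... | no _     | yes refl = qj
      ... | no k≢i   | no k≢j   = qk k≢i k≢j

    E₁*-β⁻¹ : (∀ k → 0# ≤ α k) → ι (+ a) * α j ≤ α i → ∀ ρ →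
              E₁* (β⁻¹ a i j i≢j) (Binary.fun (𝓟 ℝ α ρ)) ≐ Binary.fun (𝓟 ℝ brunStep ρ)
    E₁*-β⁻¹ 0≤α aαj≤αi ρ x k = ≡.trans
      (E₁*-plane ρ 0≤α (β⁻¹ a i j i≢j) 0≤step
        (λ k → R.trans (abelianize-∙ α (word (β⁻¹ a i j i≢j k)))
                       (β⁻¹-length {brunStep} brunStep-i brunStep-j brunStep-k k)) x k)
      (≡.sym (plane-value ρ 0≤step x k))
      where
      0≤step : ∀ k → 0# ≤ brunStep k
      0≤step = brunStep-nonNegative 0≤α aαj≤αi

  -- If the non-zero entry is at i, then αⱼ = 0; otherwise αᵢ = 0, and αⱼ ≤ αᵢ.
  X₀⇒second≯0 : ∀ {d} {α : Vector Carrier d} {i j} → X₀ ℝ α → i ≢ j → α j ≤ α i → ¬ 0# < α j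
  X₀⇒second≯0 {α = α} {i} {j} (l , m , _ , α≈) i≢j αj≤αi 0<αj = choose (m Fin.≟ i)
    where
    vanish : ∀ k → m ≢ k → ¬ 0# < α k
    vanish k m≢k 0<αk = O.irrefl (R.sym (R.trans (α≈ k)
      (R.trans (R.*-congˡ (R.reflexive (≡.cong ι (δ-≢ m≢k)))) (R.zeroʳ l)))) 0<αk

    choose : ¬ Dec (m ≡ i)
    choose (yes refl) = vanish j i≢j 0<αj
    choose (no m≢i)   = vanish i m≢i (<-≤-trans 0<αj αj≤αi)

  -- If αⱼ = 0, all entries except αᵢ vanish. As α is not zero, αᵢ > 0, and α = αᵢ eᵢ would lie in
  -- `X₀`.
  maxPair⇒0<second : ∀ {d} {α : Vector Carrier d} {i j} → X ℝ α → ¬ X₀ ℝ α → MaxPair ℝ α (i , j) → 0# < α j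
  maxPair⇒0<second {α = α} {i} {j} (0≤α , α≉0) α∉X₀ (i≢j , maxᵢ , maxⱼ) = ≤∧≉⇒< (0≤α j) λ 0≈αj →
    α∉X₀ (α i , i , ≤∧≉⇒< (0≤α i) (λ 0≈αi → α≉0 λ k →
             ≤-antisym (≤-respʳ-≈ (R.sym 0≈αi) (maxᵢ k)) (0≤α k)) ,
          multiple 0≈αj)
    where
    multiple : 0# ≈ α j → ∀ k → α k ≈ α i * ι (δ i k)
    multiple 0≈αj k with i Fin.≟ k
    ... | yes refl = R.sym (R.trans (R.*-congˡ ι-1) (R.*-identityʳ (α i)))
    ... | no i≢k   = R.trans (≤-antisym (≤-respʳ-≈ (R.sym 0≈αj) (maxⱼ k (i≢k ∘ ≡.sym))) (0≤α k))
                             (R.sym (R.zeroʳ (α i)))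

-- The second case of `brunCase` does not record that α lies outside `X₀`; repeating its case
-- distinction recovers this.
brunCase-∉X₀ : ∀ (em : ExcludedMiddle 0ℓ) ℝ {d} (3≤d : 3 ℕ.≤ d) α {c} → brunCase em ℝ 3≤d α ≡ inj₂ c → ¬ X₀ ℝ α
brunCase-∉X₀ em ℝ 3≤d α eq with em {X₀ ℝ α} | eq
... | no α∉X₀ | _ = α∉X₀

-- Matching the cases of the two maps.

open import Data.Nat.Base using (_≤_)

theorem5p6 : (em : ExcludedMiddle 0ℓ) (ℝ : Reals) (d : ℕ) (3≤d : 3 ≤ d)
    (α : Vector (Reals.Carrier ℝ) d) → X ℝ α → (ρ : Reals.Carrier ℝ) →
    T̃ em (𝓟 ℝ α ρ) ≐ Binary.fun (𝓟 ℝ (brunMap em ℝ 3≤d α) ρ)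
theorem5p6 em ℝ d 3≤d α α∈X@(0≤α , _) ρ =
  -- Both case distinctions become arguments, so that matching on them reduces the two maps.
  by (t̃Case em (𝓟 ℝ α ρ)) (brunCase em ℝ 3≤d α) (brunCase-∉X₀ em ℝ 3≤d α)
  where
  open Reals ℝ using (Carrier; ∑; ι; _*_; _⁻¹)
  open Arithmetic ℝ using (module R)
  open Planes ℝ using (∑-δ)
  open Brun ℝ
  open PlaneRuns em ℝ 0≤α ρ

  image : BrunCase em ℝ 3≤d α → Vector Carrier d
  image c r = ∑ λ l → ι (proj₁ (B-by-invertible em ℝ 3≤d c) r l) * α l

  step : ∀ {i j} (i≢j : i ≢ j) {a k} → k ≡ + a → Reals._≤_ ℝ (ι (+ a) * α j) (α i) →
         E₁* (β⁻¹ a i j i≢j) (Binary.fun (𝓟 ℝ α ρ)) ≐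
         Binary.fun (𝓟 ℝ (λ r → ∑ λ l → ι (block i j 0ℤ 1ℤ 1ℤ (ℤ.- k) r l) * α l) ρ)
  step i≢j {a} refl aαj≤αi = E₁*-β⁻¹ α i≢j a 0≤α aαj≤αi ρ

  same-pair : ∀ {i j p} (t : Least _<ₗₑₓ_ (Admissible (𝓟 ℝ α ρ)) (i , j)) (c : Least _<ₗₑₓ_ (MaxPair ℝ α) p) →
              (i , j) ≡ p → T̃-by em (inj₂ ((i , j) , t)) ≐ Binary.fun (𝓟 ℝ (image (inj₂ (p , c))) ρ)
  same-pair {i} {j} ((i≢j , unit , finite) , _) ((_ , maxᵢ , _) , _) refl =
    step i≢j (proj₂ quotient) (proj₁ quotient)
    where
    quotient = ⌊/⌋-shortest-run j i (proj₂ (admissible⇒maxPair (i≢j , unit , finite))) (maxᵢ j)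
      (proj₂ (leastℕ em (RunOfLength em (𝓟 ℝ α ρ) j i) finite))

  by : (t : T̃Case em (𝓟 ℝ α ρ)) (c : BrunCase em ℝ 3≤d α) →
       (∀ {p} → c ≡ inj₂ p → ¬ X₀ ℝ α) → T̃-by em t ≐ Binary.fun (𝓟 ℝ (image c) ρ)
  -- Both maps are the identity here, but multiplication by the identity matrix returns α only up to
  -- `≈`.
  by (inj₁ _) (inj₁ _) _ = 𝓟-cong 0≤α (λ r → R.sym (∑-δ r α)) ρ
  by (inj₁ none) (inj₂ (p , maximal , _)) ∉X₀ =
    contradiction (p , maxPair⇒admissible maximal (maxPair⇒0<second α∈X (∉X₀ refl) maximal)) none
  by (inj₂ (_ , admissible , _)) (inj₁ α∈X₀) _ =
    let (i≢j , maxᵢ , _) , 0<αj = admissible⇒maxPair admissible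
    in contradiction 0<αj (X₀⇒second≯0 α∈X₀ i≢j (maxᵢ _))
  -- The second largest entry is positive, so each of the two least pairs satisfies the condition
  -- defining the other.
  by (inj₂ (_ , t@(admissible , _))) (inj₂ (_ , c@(maximal , _))) ∉X₀ = same-pair t c
    (Least-unique t c (proj₁ (admissible⇒maxPair admissible))
      (maxPair⇒admissible maximal (maxPair⇒0<second α∈X (∉X₀ refl) maximal)))
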